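{- The following identity holds (as formal power series in $t$ with coefficients in $\mathbb{C}_\infty$, equivalently as functions of $t\in\mathbb{C}_\infty$ with $|t|<q$): $$L(\chi_t,1)=-\frac{\widetilde{\pi}}{(t-\theta)\,s_{\mathrm{Car}}(t)},$$ where $L(\chi_t,1)=\sum_{a\in A^+}\chi_t(a)a^{ -1}$.
   Context: Let $q=p^e$ be a power of a prime $p$ ($e>0$), $A=\mathbb{F}_q[\theta]$ with $\theta$ an indeterminate, $K=\mathbb{F}_q(\theta)$, with absolute value $|a|=q^{\deg_\theta a}$, so $|\theta|=q$. Let $K_\infty=\mathbb{F}_q((1/\theta))$ be the completion of $K$, and $\mathbb{C}_\infty$ the completion of an algebraic closure of $K_\infty$. $A^+$ is the set of monic polynomials of $A$. For $t$ an indeterminate or an element of $\mathbb{C}_\infty$, $\chi_t(a)=a(t)$ denotes the result of substituting $t$ for $\theta$ in $a\in A$. For an integer $\alpha>0$, $L(\chi_t,\alpha)=\sum_{a\in A^+}\chi_t(a)a^{ -\alpha}$, a well-defined element of $K_\infty[[t]]$ which converges for $t\in\mathbb{C}_\infty$ with $\log_q|t|<\alpha$. Carlitz exponential: $e_{\mathrm{Car}}(\eta)=\sum_{n\ge0}\eta^{q^n}/d_n$ for $\eta\in\mathbb{C}_\infty$, where $d_0=1$, $d_i=[i][i-1]^q\cdots[1]^{q^{i-1}}$ and $[i]=\theta^{q^i}-\theta$ for $i>0$. $\widetilde{\pi}$ is a fixed fundamental period of $e_{\mathrm{Car}}$ (a generator of the $A$-module $\ker e_{\mathrm{Car}}$),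 given, for a choice of a $(q-1)$-th root of $-\theta$, by $\widetilde{\pi}=\theta(-\theta)^{1/(q-1)}\prod_{i\ge1}(1-\theta^{1-q^i})^{ -1}$. $$s_{\mathrm{Car}}(t)=\sum_{i=0}^\infty e_{\mathrm{Car}}\left(\frac{\widetilde{\pi}}{\theta^{i+1}}\right)t^i=\sum_{n=0}^\infty\frac{\widetilde{\pi}^{q^n}}{d_n(\theta^{q^n}-t)},$$ which converges for $|t|<q$. -}

module Defs where

open import Algebra.Bundles using (CommutativeRing)
open import Algebra.Morphism.Structures using (module RingMorphisms)
import Algebra.Properties.Monoid.Sum as MonoidSum
import Algebra.Properties.Semiring.Exp as SemiringExp
open import Data.Fin.Base using (Fin; toℕ)
import Data.Integer.Base as ℤ
open import Data.List.Base using (List; []; _∷_; foldr; map)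
open import Data.Nat.Base as ℕ using (ℕ; zero; suc; _∸_)
open import Data.Product.Base using (∃; ∃-syntax; _×_)
open import Data.Rational.Base as ℚ using (ℚ)
open import Data.Sum.Base using (_⊎_)
open import Data.Vec.Base using (Vec; []; _∷_; toList; _∷ʳ_)
open import Data.Vec.Relation.Unary.All using (All)
open import Function.Bundles using (Inverse; _⇔_)
open import Level using (Level; _⊔_) renaming (suc to lsuc)
import Relation.Binary.Construct.Add.Infimum.NonStrict as InfimumOrder
open import Relation.Binary.PropositionalEquality using (_≡_) renaming (setoid to ≡-setoid)
open import Relation.Nullary.Construct.Add.Infimum using (_₋; ⊥₋; [_])
open import Relation.Nullary.Negation.Core using (¬_)

-- The inverse is total; its value at 0# is unspecified.
record Field c ℓ : Set (lsuc (c ⊔ ℓ)) where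
  field
    commutativeRing : CommutativeRing c ℓ
  open CommutativeRing commutativeRing public
  infix 9 _⁻¹
  field
    1≉0     : ¬ (1# ≈ 0#)
    _⁻¹     : Carrier → Carrier
    ⁻¹-cong : ∀ {x y} → x ≈ y → x ⁻¹ ≈ y ⁻¹
    *-inverseʳ : ∀ x → ¬ (x ≈ 0#) → x * x ⁻¹ ≈ 1#

  open SemiringExp semiring public using (_^_)
  open MonoidSum +-monoid public using (sum)
  open MonoidSum *-monoid public using () renaming (sum to product)

record FiniteField c ℓ (q : ℕ) : Set (lsuc (c ⊔ ℓ)) where
  field
    fld         : Field c ℓ
  open Field fld public
  field
    enumeration : Inverse (≡-setoid (Fin q)) setoid

-- ℚ ∪ {-∞}, the range of log_q |_| : every nonzero element of ℂ∞ has absolute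
-- value in q^ℚ.
ℚ₋ : Set
ℚ₋ = ℚ ₋

open InfimumOrder ℚ._≤_ public using (_≤₋_)

infixl 6 _+₋_
_+₋_ : ℚ₋ → ℚ₋ → ℚ₋
[ x ] +₋ [ y ] = [ x ℚ.+ y ]
[ _ ] +₋ ⊥₋    = ⊥₋
⊥₋    +₋ _     = ⊥₋

ℕ→ℚ : ℕ → ℚ
ℕ→ℚ n = (ℤ.+ n) ℚ./ 1

-- Polynomials are lists of coefficients, constant term first.
module Polynomial {c ℓ} (F : Field c ℓ) where
  open Field F

  eval : List Carrier → Carrier → Carrier
  eval f x = foldr (λ a r → a + x * r) 0# f

  coeff : List Carrier → ℕ → Carrier
  coeff []      _       = 0#
  coeff (a ∷ _) zero    = a
  coeff (_ ∷ f) (suc j) = coeff f j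

  -- X^d + v_{d-1} X^{d-1} + ... + v_0
  monic : ∀ {d} → Vec Carrier d → List Carrier
  monic v = toList (v ∷ʳ 1#)

-- The completion of an algebraic closure of 𝔽_q((1/θ)), described up to
-- isomorphism.  The intermediate fields are the following subsets of the
-- complete field ℂ∞: K is the set of quotients f(θ)/g(θ), K∞ the topological
-- closure of K, and K̄∞ the set of elements algebraic over K∞.
record Cinf {a ℓ₁ q} (𝔽q : FiniteField a ℓ₁ q) c ℓ₂
       : Set (a ⊔ ℓ₁ ⊔ lsuc (c ⊔ ℓ₂)) where
  private module 𝔽 = FiniteField 𝔽q
  field
    fld : Field c ℓ₂
  open Field fld public
  open Polynomial fld using (eval; monic)

  field
    ι     : 𝔽.Carrier → Carrier
    ι-hom : RingMorphisms.IsRingHomomorphism 𝔽.rawRing rawRing ι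
    θ     : Carrier

  -- The image in ℂ∞ of the element of A = 𝔽_q[θ] with the given coefficients.
  ⟦_⟧ : List 𝔽.Carrier → Carrier
  ⟦ f ⟧ = eval (map ι f) θ

  field
    log∣_∣     : Carrier → ℚ₋
    log-cong   : ∀ {x y} → x ≈ y → log∣ x ∣ ≡ log∣ y ∣
    log-0      : ∀ x → (log∣ x ∣ ≡ ⊥₋) ⇔ (x ≈ 0#)
    log-*      : ∀ x y → log∣ x * y ∣ ≡ log∣ x ∣ +₋ log∣ y ∣
    log-+      : ∀ x y → log∣ x + y ∣ ≤₋ log∣ x ∣ ⊎ log∣ x + y ∣ ≤₋ log∣ y ∣
    -- |a| = q^{deg a} for nonzero a in A.  In particular θ is transcendental
    -- over 𝔽_q.
    log-degree : ∀ {d} (v : Vec 𝔽.Carrier d) b → ¬ (b 𝔽.≈ 𝔽.0#) →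
                 log∣ ⟦ toList (v ∷ʳ b) ⟧ ∣ ≡ [ ℕ→ℚ d ]

  Cauchy : (ℕ → Carrier) → Set
  Cauchy f = ∀ (r : ℚ) → ∃[ N ] ∀ m n → N ℕ.≤ m → N ℕ.≤ n →
             log∣ f m - f n ∣ ≤₋ [ r ]

  _⟶_ : (ℕ → Carrier) → Carrier → Set
  f ⟶ x = ∀ (r : ℚ) → ∃[ N ] ∀ n → N ℕ.≤ n → log∣ f n - x ∣ ≤₋ [ r ]

  -- Completeness, with the limit as a total operation whose value is
  -- unspecified on sequences that are not Cauchy.
  field
    lim           : (ℕ → Carrier) → Carrier
    lim-converges : ∀ f → Cauchy f → f ⟶ lim f

  ∈K : Carrier → Set (a ⊔ ℓ₂)
  ∈K x = ∃[ f ] ∃[ g ] (¬ (⟦ g ⟧ ≈ 0#) × x ≈ ⟦ f ⟧ * ⟦ g ⟧ ⁻¹)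

  ∈K∞ : Carrier → Set (a ⊔ c ⊔ ℓ₂)
  ∈K∞ x = ∀ (r : ℚ) → ∃[ y ] (∈K y × log∣ x - y ∣ ≤₋ [ r ])

  ∈K̄∞ : Carrier → Set (a ⊔ c ⊔ ℓ₂)
  ∈K̄∞ x = ∃[ d ] ∃ λ (v : Vec Carrier d) → All ∈K∞ v × eval (monic v) x ≈ 0#

  field
    K̄∞-closed : ∀ {d} (v : Vec Carrier (suc d)) → All ∈K̄∞ v →
                ∃[ x ] (∈K̄∞ x × eval (monic v) x ≈ 0#)
    K̄∞-dense  : ∀ x (r : ℚ) → ∃[ y ] (∈K̄∞ y × log∣ x - y ∣ ≤₋ [ r ])

module Carlitz {a ℓ₁ c ℓ₂ q} {𝔽q : FiniteField a ℓ₁ q} (ℂ∞ : Cinf 𝔽q c ℓ₂) where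
  private module 𝔽 = FiniteField 𝔽q
  open Cinf ℂ∞
  open Polynomial 𝔽.fld using (coeff; monic)

  ∑< ∏< : ℕ → (ℕ → Carrier) → Carrier
  ∑< n f = sum     {n} (λ i → f (toℕ i))
  ∏< n f = product {n} (λ i → f (toℕ i))

  ∑∞ ∏∞ : (ℕ → Carrier) → Carrier
  ∑∞ f = lim (λ n → ∑< n f)
  ∏∞ f = lim (λ n → ∏< n f)

  -- Sum over all (v_0 , … , v_{d-1}) in 𝔽_q^d.
  ∑𝔽^ : ∀ d → (Vec 𝔽.Carrier d → Carrier) → Carrier
  ∑𝔽^ zero    f = f []
  ∑𝔽^ (suc d) f =
    sum (λ i → ∑𝔽^ d (λ v → f (Inverse.to 𝔽.enumeration i ∷ v)))

  -- Sum over A⁺, taken by increasing degree.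
  ∑A⁺ : (List 𝔽.Carrier → Carrier) → Carrier
  ∑A⁺ f = ∑∞ (λ d → ∑𝔽^ d (λ v → f (monic v)))

  [_]q : ℕ → Carrier
  [ i ]q = θ ^ (q ℕ.^ i) - θ

  d : ℕ → Carrier
  d i = ∏< i (λ j → [ i ∸ j ]q ^ (q ℕ.^ j))

  eCar : Carrier → Carrier
  eCar η = ∑∞ (λ n → η ^ (q ℕ.^ n) * d n ⁻¹)

  record IsFundamentalPeriod (π̃ : Carrier) : Set (a ⊔ c ⊔ ℓ₂) where
    field
      kernel       : ∀ η → (eCar η ≈ 0#) ⇔ (∃[ f ] η ≈ ⟦ f ⟧ * π̃)
      root         : Carrier
      root-correct : root ^ (q ∸ 1) ≈ - θ
      -- θ^{1-q^i} is written (θ⁻¹)^{q^i-1}; the index is shifted to start at 1.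
      formula      : π̃ ≈ θ * root *
                     ∏∞ (λ i → (1# - (θ ⁻¹) ^ (q ℕ.^ suc i ∸ 1)) ⁻¹)

  -- ℂ∞[[t]]
  PowerSeries : Set c
  PowerSeries = ℕ → Carrier

  infix  4 _≋_ _≋_/_
  infixl 7 _⊛_
  infixl 6 _⊖_

  _≋_ : PowerSeries → PowerSeries → Set ℓ₂
  f ≋ g = ∀ n → f n ≈ g n

  _⊖_ _⊛_ : PowerSeries → PowerSeries → PowerSeries
  (f ⊖ g) n = f n - g n
  (f ⊛ g) n = ∑< (suc n) (λ i → f i * g (n ∸ i))

  const : Carrier → PowerSeries
  const x zero    = x
  const x (suc _) = 0#

  t : PowerSeries
  t 1 = 1#
  t _ = 0#

  -- f = g / h, where h is required to be a unit of ℂ∞[[t]].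
  _≋_/_ : PowerSeries → PowerSeries → PowerSeries → Set (c ⊔ ℓ₂)
  f ≋ g / h = ∃[ u ] (h ⊛ u ≋ const 1# × f ≋ g ⊛ u)

  sCar : Carrier → PowerSeries
  sCar π̃ i = eCar (π̃ * (θ ^ suc i) ⁻¹)

  -- L(χ_t, α): the coefficient of t^j in χ_t(a) is the j-th coefficient of a.
  L : ℕ → PowerSeries
  L α j = ∑A⁺ (λ f → ι (coeff f j) * (⟦ f ⟧ ^ α) ⁻¹)

{-# OPTIONS --safe #-}

-- Write u = 1/θ, ℓ_d = ∏_{1≤i≤d} (θ − θ^{q^i}) and let a(t)/a be summed over
-- the monic a of degree d.  The sum is ∏_{i<d} (t − θ^{q^i}) / ℓ_d: adding up
-- the coefficients of a one at a time, this reduces to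
-- ∑_{c∈𝔽_q} 1/(y + c) = −1/(y^q − y) and to Carlitz's expansion of t^d in the
-- polynomials ∏_{i<k} (t − θ^{q^i}).  The sums telescope, so that L(χ_t,1) is the
-- coefficientwise limit of G_n = ∏_{1≤i≤n} (t − θ^{q^i}) / (θ − θ^{q^i}).
--
-- From e(θη) = θ e(η) + e(η)^q and e(π̃) = 0 the coefficients λ_j of s = s_Car
-- satisfy λ_{j−1} = θ λ_j + λ_j^q, i.e. raising the coefficients of s to the
-- power q is multiplication by t − θ.  Hence (t − θ) s G_n has the coefficients
-- λ_j^{q^{n+1}} / ℓ_n.  With ρ the chosen (q−1)-th root of −θ one has
-- |λ_j| < |ρ| for j > 0 and |λ_0 − ρ| < |ρ|, and the latter forces λ_0 = ρ.
-- So the coefficients with j > 0 tend to 0, while the constant one is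
-- −θ ρ ∏_{1≤i≤n} (1 − θ^{1−q^i})⁻¹, which tends to −π̃.
module Submission where

-- The size of `root` is in general a fractional power of q and is never computed. Elements are
-- compared with one another, mostly with multiples of `root * u ^ n`, and a factor `u` on the
-- larger side replaces strict inequality.
--
-- Every limit has an explicit rate `C * u ^ n`; by the ultrametric inequality a bound on successive
-- differences is enough. A coefficient of a product of power series is a finite sum, so the limit
-- over n is taken one coefficient at a time and ℂ∞[[t]] needs no topology.
--
-- The equality λ_0 = ρ rests on the recurrence at index 0, which says λ_0^q = -θ λ_0. The root ρ
-- solves the same equation, hence so does the difference by additivity of the q-th power, and a
-- nonzero solution must have absolute value |ρ|. This is also where the root in the product formula
-- for π̃ gets tied to the series s.
--
-- That (t - θ) s is a unit is not shown beforehand: the limit identity (t - θ) s L = -π̃ exhibits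
-- its inverse -L/π̃.

open import Algebra.Bundles using (CommutativeMonoid; CommutativeRing)
open import Algebra.Morphism.Structures using (module RingMorphisms)
open import Data.Empty using (⊥-elim)
open import Data.Fin.Base using (Fin; zero; suc; toℕ)
open import Data.Nat.Base as ℕ using (ℕ; zero; suc; z≤n; s≤s; _∸_)
import Data.Nat.Properties as ℕ
open import Data.Nat.Primality using (Prime)
open import Data.Product.Base using (∃-syntax; _,_)
open import Defs
open import Function.Base using (_∘_)
open import Function.Bundles using (Equivalence; Inverse)
open import Level using (_⊔_)
open import Relation.Binary.PropositionalEquality as ≡ using (_≡_; _≢_)
open import Relation.Nullary.Decidable.Core using (Dec; yes; no)
open import Relation.Nullary.Negation.Core using (¬_)

-- The ring solver with coefficients in ℤ: unlike the carrier of an abstract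
-- ring, ℤ has computing operations, so that cancellation is detected.
module IntegerRingSolver {c ℓ} (R : CommutativeRing c ℓ) where
  open CommutativeRing R
  open import Algebra.Properties.Ring ring using (-‿distribˡ-*; -‿distribʳ-*)
  open import Algebra.Properties.Group +-group using (ε⁻¹≈ε; ⁻¹-involutive)
  open import Algebra.Properties.AbelianGroup +-abelianGroup using (⁻¹-∙-comm)
  open import Algebra.Properties.Semiring.Mult.TCOptimised semiring
    using (_×_; 1+×; ×-homo-+; ×1-homo-*)
  open import Algebra.Solver.Ring.AlmostCommutativeRing
    using (fromCommutativeRing; _-Raw-AlmostCommutative⟶_)
  import Algebra.Solver.Ring
  open import Data.Integer.Base as ℤ using (ℤ; +_; -[1+_]; _⊖_)
  import Data.Integer.Properties as ℤ
  open import Data.Maybe.Base using (Maybe; just; nothing)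
  open import Relation.Binary.Reasoning.Setoid setoid

  fromℤ : ℤ → Carrier
  fromℤ (+ n)    = n × 1#
  fromℤ -[1+ n ] = - (suc n × 1#)

  private
    cancel-1 : ∀ x y → x - y ≈ (1# + x) - (1# + y)
    cancel-1 x y = begin
      x - y                     ≈⟨ +-identityˡ _ ⟨
      0# + (x - y)              ≈⟨ +-congʳ (-‿inverseʳ 1#) ⟨
      (1# - 1#) + (x - y)       ≈⟨ +-assoc _ _ _ ⟩
      1# + (- 1# + (x - y))     ≈⟨ +-congˡ (+-assoc _ _ _) ⟨
      1# + ((- 1# + x) - y)     ≈⟨ +-congˡ (+-congʳ (+-comm _ _)) ⟩
      1# + ((x - 1#) - y)       ≈⟨ +-congˡ (+-assoc _ _ _) ⟩
      1# + (x + (- 1# - y))     ≈⟨ +-congˡ (+-congˡ (⁻¹-∙-comm _ _)) ⟩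
      1# + (x - (1# + y))       ≈⟨ +-assoc _ _ _ ⟨
      (1# + x) - (1# + y)       ∎

  fromℤ-⊖ : ∀ m n → fromℤ (m ⊖ n) ≈ m × 1# - n × 1#
  fromℤ-⊖ m       zero    = sym (trans (+-congˡ ε⁻¹≈ε) (+-identityʳ _))
  fromℤ-⊖ zero    (suc n) = sym (+-identityˡ _)
  fromℤ-⊖ (suc m) (suc n) = begin
    fromℤ (suc m ⊖ suc n)           ≡⟨ ≡.cong fromℤ (ℤ.[1+m]⊖[1+n]≡m⊖n m n) ⟩
    fromℤ (m ⊖ n)                   ≈⟨ fromℤ-⊖ m n ⟩
    m × 1# - n × 1#                 ≈⟨ cancel-1 _ _ ⟩
    (1# + m × 1#) - (1# + n × 1#)   ≈⟨ +-cong (1+× m 1#) (-‿cong (1+× n 1#)) ⟨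
    suc m × 1# - suc n × 1#         ∎

  fromℤ-neg : ∀ i → fromℤ (ℤ.- i) ≈ - fromℤ i
  fromℤ-neg (+ zero)    = sym ε⁻¹≈ε
  fromℤ-neg (+ (suc n)) = refl
  fromℤ-neg -[1+ n ]    = sym (⁻¹-involutive _)

  fromℤ-+ : ∀ i j → fromℤ (i ℤ.+ j) ≈ fromℤ i + fromℤ j
  fromℤ-+ (+ m)    (+ n)    = ×-homo-+ 1# m n
  fromℤ-+ (+ m)    -[1+ n ] = fromℤ-⊖ m (suc n)
  fromℤ-+ -[1+ m ] (+ n)    = trans (fromℤ-⊖ n (suc m)) (+-comm _ _)
  fromℤ-+ -[1+ m ] -[1+ n ] = begin
    - (suc (suc (m ℕ.+ n)) × 1#)        ≡⟨ ≡.cong (λ k → - (suc k × 1#)) (ℕ.+-suc m n) ⟨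
    - ((suc m ℕ.+ suc n) × 1#)          ≈⟨ -‿cong (×-homo-+ 1# (suc m) (suc n)) ⟩
    - (suc m × 1# + suc n × 1#)         ≈⟨ ⁻¹-∙-comm _ _ ⟨
    - (suc m × 1#) - (suc n × 1#)       ∎

  private
    fromℤ-+* : ∀ m j → fromℤ (+ m ℤ.* j) ≈ m × 1# * fromℤ j
    fromℤ-+* m (+ n)    = trans (reflexive (≡.cong fromℤ (≡.sym (ℤ.pos-* m n)))) (×1-homo-* m n)
    fromℤ-+* m -[1+ n ] = begin
      fromℤ (+ m ℤ.* ℤ.- (+ suc n))      ≡⟨ ≡.cong fromℤ (ℤ.neg-distribʳ-* (+ m) (+ suc n)) ⟨
      fromℤ (ℤ.- (+ m ℤ.* + suc n))      ≈⟨ fromℤ-neg (+ m ℤ.* + suc n) ⟩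
      - fromℤ (+ m ℤ.* + suc n)          ≈⟨ -‿cong (fromℤ-+* m (+ suc n)) ⟩
      - (m × 1# * suc n × 1#)            ≈⟨ -‿distribʳ-* _ _ ⟩
      m × 1# * - (suc n × 1#)            ∎

  fromℤ-* : ∀ i j → fromℤ (i ℤ.* j) ≈ fromℤ i * fromℤ j
  fromℤ-* (+ m)    j = fromℤ-+* m j
  fromℤ-* -[1+ m ] j = begin
    fromℤ (ℤ.- (+ suc m) ℤ.* j)        ≡⟨ ≡.cong fromℤ (ℤ.neg-distribˡ-* (+ suc m) j) ⟨
    fromℤ (ℤ.- (+ suc m ℤ.* j))        ≈⟨ fromℤ-neg (+ suc m ℤ.* j) ⟩
    - fromℤ (+ suc m ℤ.* j)            ≈⟨ -‿cong (fromℤ-+* (suc m) j) ⟩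
    - (suc m × 1# * fromℤ j)           ≈⟨ -‿distribˡ-* _ _ ⟩
    - (suc m × 1#) * fromℤ j           ∎

  fromℤ-morphism : ℤ.+-*-rawRing -Raw-AlmostCommutative⟶ fromCommutativeRing R
  fromℤ-morphism = record
    { ⟦_⟧    = fromℤ
    ; +-homo = fromℤ-+
    ; *-homo = fromℤ-*
    ; -‿homo = fromℤ-neg
    ; 0-homo = refl
    ; 1-homo = refl
    }

  private
    coeff≟ : ∀ i j → Maybe (fromℤ i ≈ fromℤ j)
    coeff≟ i j with i ℤ.≟ j
    ... | yes i≡j = just (reflexive (≡.cong fromℤ i≡j))
    ... | no  _   = nothing

  open Algebra.Solver.Ring ℤ.+-*-rawRing (fromCommutativeRing R) fromℤ-morphism coeff≟ public
    using (solve; con; _:=_; _:+_; _:*_; _:-_; :-_; Polynomial)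

  𝟘 𝟙 : ∀ {n} → Polynomial n
  𝟘 = con (+ 0)
  𝟙 = con (+ 1)

-- Finite sums in a commutative monoid, used both additively and multiplicatively.

module SumProperties {c ℓ} (M : CommutativeMonoid c ℓ) where
  open CommutativeMonoid M renaming (ε to 0#; _∙_ to _+_)
  open import Algebra.Properties.CommutativeMonoid.Sum M
  open import Data.Fin.Properties using (suc-injective; toℕ-inject₁; toℕ-fromℕ)

  sum-zero : ∀ {n} {f : Fin n → Carrier} → (∀ i → f i ≈ 0#) → sum f ≈ 0#
  sum-zero {n} f≈0 = trans (sum-cong-≋ f≈0) (sum-replicate-zero n)

  sum-single : ∀ {n} {f : Fin n → Carrier} i → (∀ j → j ≢ i → f j ≈ 0#) → sum f ≈ f i
  sum-single {suc n} zero    f≈0 = trans (∙-congˡ (sum-zero (λ j → f≈0 (suc j) λ ()))) (identityʳ _)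
  sum-single {suc n} (suc i) f≈0 =
    trans (∙-cong (f≈0 zero λ ()) (sum-single i (λ j j≢i → f≈0 (suc j) (j≢i ∘ suc-injective))))
          (identityˡ _)

  sum-snoc : ∀ n (f : ℕ → Carrier) →
             sum {suc n} (f ∘ toℕ) ≈ sum {n} (f ∘ toℕ) + f n
  sum-snoc n f = trans (sum-init-last {n} (f ∘ toℕ))
    (∙-cong (sum-cong-≋ {n} λ i → reflexive (≡.cong f (toℕ-inject₁ i)))
            (reflexive (≡.cong f (toℕ-fromℕ n))))

-- Divisibility of the inner binomial coefficients by a prime.

module PrimeDividesBinomial where
  open import Data.Nat.Base
  open import Data.Nat.Combinatorics using (_C_; nC1≡n; nCk+nC[k+1]≡[n+1]C[k+1])
  open import Data.Nat.Divisibility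
  open import Data.Nat.Primality
  open import Data.Nat.Properties
  open import Data.Nat.Solver using (module +-*-Solver)
  open import Data.Sum.Base using (inj₁; inj₂)
  open import Relation.Binary.PropositionalEquality
  open import Relation.Nullary.Negation using (contradiction)
  open ≡-Reasoning

  [1+k]*[1+n]C[1+k] : ∀ n k → suc k * (suc n C suc k) ≡ suc n * (n C k)
  [1+k]*[1+n]C[1+k] n zero = begin
    1 * (suc n C 1)   ≡⟨ cong (1 *_) (nC1≡n (suc n)) ⟩
    1 * suc n         ≡⟨ *-comm 1 (suc n) ⟩
    suc n * 1         ∎
  [1+k]*[1+n]C[1+k] zero (suc k) = *-zeroʳ (suc (suc k))
  [1+k]*[1+n]C[1+k] (suc n) (suc k) = begin
    suc (suc k) * (suc (suc n) C suc (suc k))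
      ≡⟨ cong (suc (suc k) *_) (nCk+nC[k+1]≡[n+1]C[k+1] (suc n) (suc k)) ⟨
    suc (suc k) * (A + B)
      ≡⟨ +-*-Solver.solve 3 (λ k A B → (con 2 :+ k) :* (A :+ B) :=
           A :+ ((con 1 :+ k) :* A :+ (con 2 :+ k) :* B)) refl k A B ⟩
    A + (suc k * A + suc (suc k) * B)
      ≡⟨ cong (A +_) (cong₂ _+_ ([1+k]*[1+n]C[1+k] n k) ([1+k]*[1+n]C[1+k] n (suc k))) ⟩
    A + (suc n * (n C k) + suc n * (n C suc k))
      ≡⟨ cong (A +_) (*-distribˡ-+ (suc n) (n C k) (n C suc k)) ⟨
    A + suc n * (n C k + n C suc k)
      ≡⟨ cong (λ z → A + suc n * z) (nCk+nC[k+1]≡[n+1]C[k+1] n k) ⟩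
    A + suc n * A ∎
    where
    open +-*-Solver
    A = suc n C suc k
    B = suc n C suc (suc k)

  -- The absorption identity above shows that the prime divides `suc k * (suc n C suc k)`, and it is
  -- too large to divide `suc k`.
  p∣pCk : ∀ {n k} → Prime (suc n) → k < n → suc n ∣ suc n C suc k
  p∣pCk {n} {k} p k<n
    with euclidsLemma (suc k) (suc n C suc k) p
           (subst (suc n ∣_) (sym ([1+k]*[1+n]C[1+k] n k)) (m∣m*n (n C k)))
  ... | inj₁ p∣1+k = contradiction (∣⇒≤ p∣1+k) (<⇒≱ (s≤s k<n))
  ... | inj₂ p∣C   = p∣C

-- Fields: division, polynomial functions, partial fractions, Frobenius.

module FieldProperties {c ℓ} (F : Field c ℓ) where
  open Field F hiding (zero)
  open IntegerRingSolver commutativeRing public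
  open import Algebra.Properties.CommutativeSemiring.Exp commutativeSemiring public
    using (^-congˡ; ^-congʳ; ^-assocʳ; ^-distrib-*)
  open import Algebra.Properties.Semiring.Mult semiring public
    using (_×_; ×-congˡ; ×-congʳ; ×-assoc-*; ×1-homo-*; ×-assocˡ)
  open import Algebra.Properties.Semiring.Sum semiring public
    using (sum-cong-≋; sum-replicate; ∑-distrib-+; *-distribˡ-sum; *-distribʳ-sum)
  open import Algebra.Properties.CommutativeSemiring.Binomial commutativeSemiring using (theorem)
  open SumProperties +-commutativeMonoid public
  open import Data.Fin.Properties using (suc-injective; toℕ<n; _≟_)
  open import Data.Nat.Combinatorics using (_C_; nCn≡1)
  open import Data.Nat.Divisibility using (_∣_; divides)
  open import Data.Product.Base using () renaming (_×_ to _∧_)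
  open import Relation.Binary.Reasoning.Setoid setoid

  x-y≈0⇒x≈y : ∀ {x y} → x - y ≈ 0# → x ≈ y
  x-y≈0⇒x≈y {x} {y} x-y≈0 = begin
    x            ≈⟨ solve 2 (λ x y → x := (x :- y) :+ y) refl x y ⟩
    (x - y) + y  ≈⟨ +-congʳ x-y≈0 ⟩
    0# + y       ≈⟨ +-identityˡ y ⟩
    y            ∎

  x≈y⇒x-y≈0 : ∀ {x y} → x ≈ y → x - y ≈ 0#
  x≈y⇒x-y≈0 x≈y = trans (+-congʳ x≈y) (-‿inverseʳ _)

  *-inverseˡ : ∀ x → ¬ (x ≈ 0#) → x ⁻¹ * x ≈ 1#
  *-inverseˡ x x≉0 = trans (*-comm _ _) (*-inverseʳ x x≉0)

  *-cancelˡ : ∀ {x y z} → ¬ (x ≈ 0#) → x * y ≈ x * z → y ≈ z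
  *-cancelˡ {x} {y} {z} x≉0 xy≈xz = begin
    y               ≈⟨ lemma y ⟩
    x ⁻¹ * (x * y)  ≈⟨ *-congˡ xy≈xz ⟩
    x ⁻¹ * (x * z)  ≈⟨ lemma z ⟨
    z               ∎
    where
    lemma : ∀ w → w ≈ x ⁻¹ * (x * w)
    lemma w = begin
      w               ≈⟨ *-identityˡ w ⟨
      1# * w          ≈⟨ *-congʳ (*-inverseˡ x x≉0) ⟨
      x ⁻¹ * x * w    ≈⟨ *-assoc _ _ _ ⟩
      x ⁻¹ * (x * w)  ∎

  integral : ∀ {x y} → ¬ (x ≈ 0#) → x * y ≈ 0# → y ≈ 0#
  integral x≉0 xy≈0 = *-cancelˡ x≉0 (trans xy≈0 (sym (zeroʳ _)))

  *-≉0 : ∀ {x y} → ¬ (x ≈ 0#) → ¬ (y ≈ 0#) → ¬ (x * y ≈ 0#)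
  *-≉0 x≉0 y≉0 xy≈0 = y≉0 (integral x≉0 xy≈0)

  ^-≉0 : ∀ {x} n → ¬ (x ≈ 0#) → ¬ (x ^ n ≈ 0#)
  ^-≉0 zero    x≉0 = 1≉0
  ^-≉0 (suc n) x≉0 = *-≉0 x≉0 (^-≉0 n x≉0)

  ⁻¹-≉0 : ∀ {x} → ¬ (x ≈ 0#) → ¬ (x ⁻¹ ≈ 0#)
  ⁻¹-≉0 {x} x≉0 e = 1≉0 (trans (sym (*-inverseʳ x x≉0)) (trans (*-congˡ e) (zeroʳ x)))

  -‿≉0 : ∀ {x} → ¬ (x ≈ 0#) → ¬ (- x ≈ 0#)
  -‿≉0 {x} x≉0 e = x≉0 (begin
    x        ≈⟨ solve 1 (λ x → x := :- (:- x)) refl x ⟩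
    - (- x)  ≈⟨ -‿cong e ⟩
    - 0#     ≈⟨ solve 0 (:- 𝟘 := 𝟘) refl ⟩
    0#       ∎)

  product-≉0 : ∀ {n} {f : Fin n → Carrier} → (∀ i → ¬ (f i ≈ 0#)) → ¬ (product f ≈ 0#)
  product-≉0 {zero}  f≉0 = 1≉0
  product-≉0 {suc n} f≉0 = *-≉0 (f≉0 zero) (product-≉0 (f≉0 ∘ suc))

  ⁻¹-unique : ∀ {x y} → x * y ≈ 1# → y ≈ x ⁻¹
  ⁻¹-unique {x} {y} xy≈1 = *-cancelˡ x≉0 (trans xy≈1 (sym (*-inverseʳ x x≉0)))
    where
    x≉0 : ¬ (x ≈ 0#)
    x≉0 x≈0 = 1≉0 (trans (sym xy≈1) (trans (*-congʳ x≈0) (zeroˡ y)))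

  1⁻¹≈1 : 1# ⁻¹ ≈ 1#
  1⁻¹≈1 = sym (⁻¹-unique (*-identityˡ 1#))

  ⁻¹-distrib-* : ∀ {x y} → ¬ (x ≈ 0#) → ¬ (y ≈ 0#) → (x * y) ⁻¹ ≈ x ⁻¹ * y ⁻¹
  ⁻¹-distrib-* {x} {y} x≉0 y≉0 = sym (⁻¹-unique (begin
    x * y * (x ⁻¹ * y ⁻¹)    ≈⟨ solve 4 (λ x y a b → x :* y :* (a :* b) := x :* a :* (y :* b))
                                  refl x y (x ⁻¹) (y ⁻¹) ⟩
    x * x ⁻¹ * (y * y ⁻¹)    ≈⟨ *-cong (*-inverseʳ x x≉0) (*-inverseʳ y y≉0) ⟩
    1# * 1#                  ≈⟨ *-identityˡ 1# ⟩
    1#                       ∎))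

  1^n≈1 : ∀ n → 1# ^ n ≈ 1#
  1^n≈1 zero    = refl
  1^n≈1 (suc n) = trans (*-identityˡ _) (1^n≈1 n)

  0^n≈0 : ∀ n → .{{ℕ.NonZero n}} → 0# ^ n ≈ 0#
  0^n≈0 (suc n) = zeroˡ _

  ⁻¹-^ : ∀ {x} → ¬ (x ≈ 0#) → ∀ n → (x ^ n) ⁻¹ ≈ (x ⁻¹) ^ n
  ⁻¹-^ {x} x≉0 n = sym (⁻¹-unique (begin
    x ^ n * (x ⁻¹) ^ n  ≈⟨ ^-distrib-* x (x ⁻¹) n ⟨
    (x * x ⁻¹) ^ n      ≈⟨ ^-congˡ n (*-inverseʳ x x≉0) ⟩
    1# ^ n              ≈⟨ 1^n≈1 n ⟩
    1#                  ∎))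

  x≈y*z⇒x*z⁻¹≈y : ∀ {x y z} → ¬ (z ≈ 0#) → x ≈ y * z → x * z ⁻¹ ≈ y
  x≈y*z⇒x*z⁻¹≈y {x} {y} {z} z≉0 x≈yz = begin
    x * z ⁻¹        ≈⟨ *-congʳ x≈yz ⟩
    y * z * z ⁻¹    ≈⟨ *-assoc _ _ _ ⟩
    y * (z * z ⁻¹)  ≈⟨ *-congˡ (*-inverseʳ z z≉0) ⟩
    y * 1#          ≈⟨ *-identityʳ y ⟩
    y               ∎

  -- Polynomial functions of degree less than n, in Horner form.
  data Poly : ℕ → (Carrier → Carrier) → Set (c ⊔ ℓ) where
    nil  : ∀ {f} → (∀ x → f x ≈ 0#) → Poly 0 f
    cons : ∀ {n f g} a → (∀ x → f x ≈ a + x * g x) → Poly n g → Poly (suc n) f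

  Poly-const : ∀ n a → Poly (suc n) (λ _ → a)
  Poly-const n a = cons a (λ x → sym (trans (+-congˡ (zeroʳ x)) (+-identityʳ a))) (Poly-0 n)
    where
    Poly-0 : ∀ n → Poly n (λ _ → 0#)
    Poly-0 zero    = nil (λ _ → refl)
    Poly-0 (suc n) = Poly-const n 0#

  Poly-+ : ∀ {n f g} → Poly n f → Poly n g → Poly n (λ x → f x + g x)
  Poly-+ (nil f≈0) (nil g≈0) = nil λ x → trans (+-cong (f≈0 x) (g≈0 x)) (+-identityˡ 0#)
  Poly-+ (cons {f = f} {f′} a f≈ P) (cons {f = g} {g′} b g≈ Q) = cons (a + b) (λ x → begin
    f x + g x                        ≈⟨ +-cong (f≈ x) (g≈ x) ⟩
    a + x * f′ x + (b + x * g′ x)    ≈⟨ solve 5 (λ a b x f g → a :+ x :* f :+ (b :+ x :* g) :=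
                                          a :+ b :+ x :* (f :+ g)) refl a b x (f′ x) (g′ x) ⟩
    a + b + x * (f′ x + g′ x)        ∎) (Poly-+ P Q)

  Poly-sum : ∀ {n k} {f : Fin k → Carrier → Carrier} → (∀ i → Poly (suc n) (f i)) →
             Poly (suc n) (λ x → sum (λ i → f i x))
  Poly-sum {n} {zero}  P = Poly-const n 0#
  Poly-sum {n} {suc k} P = Poly-+ (P zero) (Poly-sum (P ∘ suc))

  -- Synthetic division: the Horner form yields the quotient by `x - s` coefficient by coefficient,
  -- with the values at `s` of the inner polynomials as coefficients.
  Poly-divide : ∀ {n f} → Poly (suc n) f → ∀ s →
                ∃[ g ] (Poly n g ∧ (∀ x → f x ≈ f s + (x - s) * g x))
  Poly-divide {zero} {f} (cons {g = g} a f≈ (nil g≈0)) s = (λ _ → 0#) , nil (λ _ → refl) , λ x → begin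
    f x                    ≈⟨ f≈a x ⟩
    a                      ≈⟨ f≈a s ⟨
    f s                    ≈⟨ +-identityʳ _ ⟨
    f s + 0#               ≈⟨ +-congˡ (zeroʳ _) ⟨
    f s + (x - s) * 0#     ∎
    where
    f≈a : ∀ x → f x ≈ a
    f≈a x = trans (f≈ x) (trans (+-congˡ (trans (*-congˡ (g≈0 x)) (zeroʳ x))) (+-identityʳ a))
  Poly-divide {suc n} {f} (cons {g = g} a f≈ P) s with Poly-divide P s
  ... | h , Q , g≈ = (λ x → g s + x * h x) , cons (g s) (λ _ → refl) Q , λ x → begin
    f x                              ≈⟨ f≈ x ⟩
    a + x * g x                      ≈⟨ +-congˡ (*-congˡ (g≈ x)) ⟩
    a + x * (g s + (x - s) * h x)    ≈⟨ solve 5 (λ a x s g h → a :+ x :* (g :+ (x :- s) :* h) :=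
                                          (a :+ s :* g) :+ (x :- s) :* (g :+ x :* h))
                                          refl a x s (g s) (h x) ⟩
    a + s * g s + (x - s) * (g s + x * h x)  ≈⟨ +-congʳ (f≈ s) ⟨
    f s + (x - s) * (g s + x * h x)  ∎

  -- Division by the first root leaves a quotient that vanishes at the others, because differences
  -- of distinct roots can be cancelled.
  Poly-roots : ∀ {n f} → Poly n f → (r : Fin n → Carrier) → (∀ {i j} → r i ≈ r j → i ≡ j) →
               (∀ i → f (r i) ≈ 0#) → ∀ x → f x ≈ 0#
  Poly-roots {zero}      (nil f≈0) r r-inj fr≈0 = f≈0
  Poly-roots {suc n} {f} P         r r-inj fr≈0 x with Poly-divide P (r zero)
  ... | g , Q , f≈ = begin
    f x                          ≈⟨ f≈ x ⟩
    f (r zero) + (x - r zero) * g x ≈⟨ +-cong (fr≈0 zero) (trans (*-congˡ (g≈0 x)) (zeroʳ _)) ⟩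
    0# + 0#                      ≈⟨ +-identityˡ 0# ⟩
    0#                           ∎
    where
    g≈0 : ∀ x → g x ≈ 0#
    g≈0 = Poly-roots Q (r ∘ suc) (suc-injective ∘ r-inj) λ i → integral
      (λ e → case-absurd (r-inj (x-y≈0⇒x≈y e)))
      (begin
        (r (suc i) - r zero) * g (r (suc i))               ≈⟨ +-identityˡ _ ⟨
        0# + (r (suc i) - r zero) * g (r (suc i))          ≈⟨ +-congʳ (fr≈0 zero) ⟨
        f (r zero) + (r (suc i) - r zero) * g (r (suc i))  ≈⟨ f≈ (r (suc i)) ⟨
        f (r (suc i))                                      ≈⟨ fr≈0 (suc i) ⟩
        0#                                                 ∎)
      where
      case-absurd : ∀ {n} {i : Fin n} → ¬ (suc i ≡ zero)
      case-absurd ()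

  -- (y^n − b^n)/(y − b)
  geometric : Carrier → ℕ → Carrier → Carrier
  geometric b zero    y = 0#
  geometric b (suc n) y = b ^ n + y * geometric b n y

  Poly-geometric : ∀ b n → Poly n (geometric b n)
  Poly-geometric b zero    = nil (λ _ → refl)
  Poly-geometric b (suc n) = cons (b ^ n) (λ _ → refl) (Poly-geometric b n)

  geometric-* : ∀ b n y → (y - b) * geometric b n y ≈ y ^ n - b ^ n
  geometric-* b zero    y = trans (zeroʳ _) (sym (-‿inverseʳ 1#))
  geometric-* b (suc n) y = begin
    (y - b) * (b ^ n + y * g)              ≈⟨ solve 4 (λ y b p g → (y :- b) :* (p :+ y :* g) :=
                                                (y :- b) :* p :+ y :* ((y :- b) :* g)) refl y b (b ^ n) g ⟩
    (y - b) * b ^ n + y * ((y - b) * g)    ≈⟨ +-congˡ (*-congˡ (geometric-* b n y)) ⟩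
    (y - b) * b ^ n + y * (y ^ n - b ^ n)  ≈⟨ solve 4 (λ y b p r → (y :- b) :* p :+ y :* (r :- p) :=
                                                y :* r :- b :* p) refl y b (b ^ n) (y ^ n) ⟩
    y * y ^ n - b * b ^ n                  ∎
    where g = geometric b n y

  -- The difference quotient of a power at `y = b` is the derivative.
  geometric-diagonal : ∀ b n → geometric b (suc n) b ≈ suc n × b ^ n
  geometric-diagonal b zero    = +-congˡ (zeroʳ b)
  geometric-diagonal b (suc n) = +-congˡ (begin
    b * geometric b (suc n) b      ≈⟨ *-congˡ (geometric-diagonal b n) ⟩
    b * (suc n × b ^ n)            ≈⟨ *-comm _ _ ⟩
    (suc n × b ^ n) * b            ≈⟨ ×-assoc-* (suc n) (b ^ n) b ⟩
    suc n × (b ^ n * b)            ≈⟨ ×-congʳ (suc n) (*-comm _ _) ⟩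
    suc n × b ^ suc n              ∎)

  n×x≈0 : ∀ n → n × 1# ≈ 0# → ∀ x → n × x ≈ 0#
  n×x≈0 n n≈0 x = begin
    n × x           ≈⟨ ×-congʳ n (*-identityˡ x) ⟨
    n × (1# * x)    ≈⟨ ×-assoc-* n 1# x ⟨
    (n × 1#) * x    ≈⟨ *-congʳ n≈0 ⟩
    0# * x          ≈⟨ zeroˡ x ⟩
    0#              ∎

  -- If b runs through the q roots of X^q − X, then
  -- ∑ ((X^q − b^q)/(X − b)) + 1 has degree less than q and vanishes at all b.
  partialFractions : ∀ {q} → .{{ℕ.NonZero q}} → q × 1# ≈ 0# → (b : Fin q → Carrier) →
    (∀ {i j} → b i ≈ b j → i ≡ j) → (∀ i → b i ^ q ≈ b i) →
    ∀ y → ¬ (y ^ q - y ≈ 0#) → sum (λ i → (y - b i) ⁻¹) ≈ - (y ^ q - y) ⁻¹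
  partialFractions {q@(suc n)} q≈0 b b-inj b^q≈b y y^q≉y = begin
    S                                    ≈⟨ x≈y*z⇒x*z⁻¹≈y y^q≉y refl ⟨
    S * (y ^ q - y) * (y ^ q - y) ⁻¹     ≈⟨ *-congʳ S*[y^q-y]≈-1 ⟩
    - 1# * (y ^ q - y) ⁻¹                ≈⟨ solve 1 (λ z → :- 𝟙 :* z := :- z) refl _ ⟩
    - (y ^ q - y) ⁻¹                     ∎
    where
    S = sum (λ i → (y - b i) ⁻¹)

    H : Carrier → Carrier
    H x = sum (λ i → geometric (b i) q x)

    δ : Fin q → Fin q → Carrier
    δ j i with i ≟ j
    ... | yes _ = 1#
    ... | no  _ = 0#

    δ-diagonal : ∀ j → δ j j ≈ 1#
    δ-diagonal j with j ≟ j
    ... | yes _   = refl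
    ... | no  j≢j = ⊥-elim (j≢j ≡.refl)

    δ-off : ∀ j i → i ≢ j → δ j i ≈ 0#
    δ-off j i i≢j with i ≟ j
    ... | yes i≡j = ⊥-elim (i≢j i≡j)
    ... | no  _   = refl

    -- For `i ≢ j` the quotient is 1, since both `b j` and `b i` equal their q-th powers. On the
    -- diagonal it is the derivative `q × b i ^ n`, which is 0, and `δ` makes up for it. So
    -- `H (b j) + 1#` is a sum of q ones.
    geometric+δ : ∀ j i → geometric (b i) q (b j) + δ j i ≈ 1#
    geometric+δ j i with i ≟ j
    ... | yes ≡.refl = begin
      geometric (b i) q (b i) + 1#  ≈⟨ +-congʳ (geometric-diagonal (b i) n) ⟩
      q × b i ^ n + 1#              ≈⟨ +-congʳ (n×x≈0 q q≈0 _) ⟩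
      0# + 1#                       ≈⟨ +-identityˡ 1# ⟩
      1#                            ∎
    ... | no i≢j = trans (+-identityʳ _) (*-cancelˡ (λ e → i≢j (≡.sym (b-inj (x-y≈0⇒x≈y e)))) (begin
      (b j - b i) * geometric (b i) q (b j)  ≈⟨ geometric-* (b i) q (b j) ⟩
      b j ^ q - b i ^ q                      ≈⟨ +-cong (b^q≈b j) (-‿cong (b^q≈b i)) ⟩
      b j - b i                              ≈⟨ *-identityʳ _ ⟨
      (b j - b i) * 1#                       ∎))

    ∑1≈0 : sum {q} (λ _ → 1#) ≈ 0#
    ∑1≈0 = trans (sum-replicate q) q≈0

    H+1≈0 : ∀ x → H x + 1# ≈ 0#
    H+1≈0 = Poly-roots (Poly-+ (Poly-sum (λ i → Poly-geometric (b i) q)) (Poly-const n 1#)) b b-inj λ j → begin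
      H (b j) + 1#                                     ≈⟨ +-congˡ (trans (sum-single j (δ-off j)) (δ-diagonal j)) ⟨
      H (b j) + sum (δ j)                              ≈⟨ ∑-distrib-+ (λ i → geometric (b i) q (b j)) (δ j) ⟨
      sum (λ i → geometric (b i) q (b j) + δ j i)      ≈⟨ sum-cong-≋ (geometric+δ j) ⟩
      sum {q} (λ _ → 1#)                               ≈⟨ ∑1≈0 ⟩
      0#                                               ∎

    y-b≉0 : ∀ i → ¬ (y - b i ≈ 0#)
    y-b≉0 i e = y^q≉y (begin
      y ^ q - y        ≈⟨ +-cong (^-congˡ q y≈b) (-‿cong y≈b) ⟩
      b i ^ q - b i    ≈⟨ x≈y⇒x-y≈0 (b^q≈b i) ⟩
      0#               ∎)
      where y≈b = x-y≈0⇒x≈y e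

    -- The added 1 turns the numerator `y ^ q - y` into `y ^ q - b i`, that is `y ^ q - b i ^ q`.
    -- Over all `i` these ones sum to 0.
    term : ∀ i → (y - b i) ⁻¹ * (y ^ q - y) + 1# ≈ geometric (b i) q y
    term i = *-cancelˡ (y-b≉0 i) (begin
      (y - b i) * ((y - b i) ⁻¹ * (y ^ q - y) + 1#)
        ≈⟨ solve 3 (λ z w x → z :* (w :* x :+ 𝟙) := z :* w :* x :+ z) refl (y - b i) ((y - b i) ⁻¹) _ ⟩
      (y - b i) * (y - b i) ⁻¹ * (y ^ q - y) + (y - b i)
        ≈⟨ +-congʳ (*-congʳ (*-inverseʳ _ (y-b≉0 i))) ⟩
      1# * (y ^ q - y) + (y - b i)
        ≈⟨ solve 3 (λ Y y b → 𝟙 :* (Y :- y) :+ (y :- b) := Y :- b) refl (y ^ q) y (b i) ⟩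
      y ^ q - b i
        ≈⟨ +-congˡ (-‿cong (b^q≈b i)) ⟨
      y ^ q - b i ^ q
        ≈⟨ geometric-* (b i) q y ⟨
      (y - b i) * geometric (b i) q y ∎)

    S*[y^q-y]≈-1 : S * (y ^ q - y) ≈ - 1#
    S*[y^q-y]≈-1 = x-y≈0⇒x≈y (begin
      S * (y ^ q - y) - - 1#
        ≈⟨ solve 1 (λ z → z :- (:- 𝟙) := z :+ 𝟙) refl _ ⟩
      S * (y ^ q - y) + 1#
        ≈⟨ +-congʳ (*-distribʳ-sum (y ^ q - y) (λ i → (y - b i) ⁻¹)) ⟩
      sum (λ i → (y - b i) ⁻¹ * (y ^ q - y)) + 1#
        ≈⟨ +-congʳ (+-identityʳ _) ⟨
      sum (λ i → (y - b i) ⁻¹ * (y ^ q - y)) + 0# + 1#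
        ≈⟨ +-congʳ (+-congˡ ∑1≈0) ⟨
      sum (λ i → (y - b i) ⁻¹ * (y ^ q - y)) + sum {q} (λ _ → 1#) + 1#
        ≈⟨ +-congʳ (∑-distrib-+ (λ i → (y - b i) ⁻¹ * (y ^ q - y)) (λ _ → 1#)) ⟨
      sum (λ i → (y - b i) ⁻¹ * (y ^ q - y) + 1#) + 1#
        ≈⟨ +-congʳ (sum-cong-≋ term) ⟩
      H y + 1#
        ≈⟨ H+1≈0 y ⟩
      0# ∎)

  -- Additivity of powers with exponent a power of the characteristic.

  AdditivePower : ℕ → Set (c ⊔ ℓ)
  AdditivePower n = ∀ x y → (x + y) ^ n ≈ x ^ n + y ^ n

  module Frobenius {p} (p-prime : Prime p) (p≈0 : p × 1# ≈ 0#) where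

    -- All inner terms of the binomial theorem vanish by `p∣pCk`. The prime is bound afresh in `go`
    -- so that it can be matched as a successor.
    +-^p : AdditivePower p
    +-^p = go p p-prime p≈0
      where
      multiple : ∀ {p k} → p × 1# ≈ 0# → p ∣ k → ∀ x → k × x ≈ 0#
      multiple {p} p≈0 (divides m ≡.refl) x = begin
        (m ℕ.* p) × x  ≈⟨ ×-assocˡ x m p ⟨
        m × (p × x)    ≈⟨ ×-congʳ m (n×x≈0 p p≈0 x) ⟩
        m × 0#         ≈⟨ trans (sym (sum-replicate m)) (sum-zero {m} (λ _ → refl)) ⟩
        0#             ∎

      go : ∀ p → Prime p → p × 1# ≈ 0# → AdditivePower p
      go (suc n) p-prime p≈0 x y = begin
        (x + y) ^ suc n
          ≈⟨ theorem (suc n) x y ⟩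
        term 0 + sum {suc n} (λ i → term (suc (toℕ i)))
          ≈⟨ +-cong term-0 (sum-snoc n (term ∘ suc)) ⟩
        y ^ suc n + (sum {n} (λ i → term (suc (toℕ i))) + term (suc n))
          ≈⟨ +-congˡ (+-cong (sum-zero {n} λ i → multiple p≈0 (PrimeDividesBinomial.p∣pCk p-prime (toℕ<n i)) _) term-n) ⟩
        y ^ suc n + (0# + x ^ suc n)
          ≈⟨ trans (+-congˡ (+-identityˡ _)) (+-comm _ _) ⟩
        x ^ suc n + y ^ suc n ∎
        where
        term : ℕ → Carrier
        term k = (suc n C k) × (x ^ k * y ^ (suc n ℕ.∸ k))

        term-0 : term 0 ≈ y ^ suc n
        term-0 = trans (+-identityʳ _) (*-identityˡ _)

        term-n : term (suc n) ≈ x ^ suc n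
        term-n = begin
          (suc n C suc n) × (x ^ suc n * y ^ (n ℕ.∸ n)) ≈⟨ ×-congˡ (nCn≡1 (suc n)) ⟩
          1 × (x ^ suc n * y ^ (n ℕ.∸ n))               ≈⟨ +-identityʳ _ ⟩
          x ^ suc n * y ^ (n ℕ.∸ n)                     ≈⟨ *-congˡ (^-congʳ y (ℕ.n∸n≡0 n)) ⟩
          x ^ suc n * 1#                                ≈⟨ *-identityʳ _ ⟩
          x ^ suc n                                     ∎

    +-^p^ : ∀ e → AdditivePower (p ℕ.^ e)
    +-^p^ zero    x y = distribʳ 1# x y
    +-^p^ (suc e) x y = begin
      (x + y) ^ (p ℕ.* p ℕ.^ e)                        ≈⟨ ^-assocʳ _ p _ ⟨
      ((x + y) ^ p) ^ (p ℕ.^ e)                        ≈⟨ ^-congˡ (p ℕ.^ e) (+-^p x y) ⟩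
      (x ^ p + y ^ p) ^ (p ℕ.^ e)                      ≈⟨ +-^p^ e _ _ ⟩
      (x ^ p) ^ (p ℕ.^ e) + (y ^ p) ^ (p ℕ.^ e)        ≈⟨ +-cong (^-assocʳ x p _) (^-assocʳ y p _) ⟩
      x ^ (p ℕ.* p ℕ.^ e) + y ^ (p ℕ.* p ℕ.^ e)        ∎

-- Finite fields: characteristic and the fixed points of the q-th power.

module FiniteFieldProperties {a ℓ q} (𝔽 : FiniteField a ℓ q) where
  open FiniteField 𝔽 hiding (zero)
  open FieldProperties fld
  import Data.Fin.Permutation as Perm
  open import Data.Fin.Properties using (_≟_; nonZeroIndex)
  open import Relation.Binary.Definitions using (Decidable)
  open import Relation.Nullary.Decidable.Core using (map′)
  import Algebra.Properties.CommutativeMonoid.Sum as Sum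
  import Relation.Binary.Reasoning.Setoid as SetoidReasoning

  open Inverse enumeration public using () renaming (to to elem)
  open Inverse enumeration using (from; from-cong)
    renaming (strictlyInverseˡ to elem-from; strictlyInverseʳ to from-elem)

  elem-injective : ∀ {i j} → elem i ≈ elem j → i ≡ j
  elem-injective {i} {j} e = ≡.trans (≡.sym (from-elem i)) (≡.trans (from-cong e) (from-elem j))

  _≈?_ : Decidable _≈_
  x ≈? y = map′ (λ e → trans (sym (elem-from x)) (trans (reflexive (≡.cong elem e)) (elem-from y)))
                from-cong (from x ≟ from y)

  order-nonZero : ℕ.NonZero q
  order-nonZero = nonZeroIndex (from 0#)

  module _ {c ℓ′} (M : CommutativeMonoid c ℓ′) where
    private
      module M = CommutativeMonoid M
      module ∑ = Sum M

    -- A bijection of the field becomes a permutation of the indices through the enumeration. It is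
    -- applied to translation by 1 in the additive monoid and to multiplication by a unit in the
    -- multiplicative one.
    sum-reindex : (h : Carrier → M.Carrier) → (∀ {x y} → x ≈ y → h x M.≈ h y) →
                  (φ ψ : Carrier → Carrier) →
                  (∀ {x y} → x ≈ y → φ x ≈ φ y) → (∀ {x y} → x ≈ y → ψ x ≈ ψ y) →
                  (∀ x → φ (ψ x) ≈ x) → (∀ x → ψ (φ x) ≈ x) →
                  ∑.sum (h ∘ elem) M.≈ ∑.sum (h ∘ φ ∘ elem)
    sum-reindex h h-cong φ ψ φ-cong ψ-cong φψ ψφ =
      M.trans (∑.sum-permute (h ∘ elem) π) (∑.sum-cong-≋ {q} λ i → h-cong (elem-from _))
      where
      inverse : ∀ (φ ψ : Carrier → Carrier) → (∀ {x y} → x ≈ y → φ x ≈ φ y) →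
                (∀ x → φ (ψ x) ≈ x) → ∀ i → from (φ (elem (from (ψ (elem i))))) ≡ i
      inverse φ ψ φ-cong φψ i =
        ≡.trans (from-cong (trans (φ-cong (elem-from _)) (φψ (elem i)))) (from-elem i)

      π : Perm.Permutation q q
      π = Perm.permutation (from ∘ φ ∘ elem) (from ∘ ψ ∘ elem)
            (inverse φ ψ φ-cong φψ) (inverse ψ φ ψ-cong ψφ)

  open SetoidReasoning setoid

  -- Translation by 1 permutes the field, so the sum S of all elements equals S + q·1.
  order×1≈0 : q × 1# ≈ 0#
  order×1≈0 = begin
    q × 1#                               ≈⟨ sum-replicate q ⟨
    T                                    ≈⟨ solve 2 (λ S T → T := (S :+ T) :- S) refl S T ⟩
    (S + T) - S                          ≈⟨ +-congʳ (∑-distrib-+ elem (λ _ → 1#)) ⟨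
    sum (λ i → elem i + 1#) - S          ≈⟨ +-congʳ (sum-reindex +-commutativeMonoid (λ x → x) (λ e → e)
                                               (_+ 1#) (_- 1#) +-congʳ +-congʳ
                                               (solve 1 (λ x → x :- 𝟙 :+ 𝟙 := x) refl)
                                               (solve 1 (λ x → x :+ 𝟙 :- 𝟙 := x) refl)) ⟨
    S - S                                ≈⟨ -‿inverseʳ S ⟩
    0#                                   ∎
    where
    S = sum elem
    T = sum {q} (λ _ → 1#)

  -- Fermat's argument: for `x ≉ 0` multiplication by `x` permutes the units, so their product P
  -- satisfies P x = P x^q.
  ^-order : ∀ x → x ^ q ≈ x
  ^-order x with x ≈? 0#
  ... | yes x≈0 = trans (^-congˡ q x≈0) (trans (0^n≈0 q {{order-nonZero}}) (sym x≈0))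
  ... | no x≉0  = *-cancelˡ P≉0 (sym (begin
    P * x                                              ≈⟨ *-comm _ _ ⟩
    x * P                                              ≈⟨ *-cong (sym ∏k≈x) (sum-reindex *-commutativeMonoid h h-cong
                                                             (x *_) (x ⁻¹ *_) *-congˡ *-congˡ
                                                             (cancel (*-inverseʳ x x≉0)) (cancel (*-inverseˡ x x≉0))) ⟩
    product (k ∘ elem) * product (h ∘ (x *_) ∘ elem)   ≈⟨ Π.∑-distrib-+ (k ∘ elem) (h ∘ (x *_) ∘ elem) ⟨
    product (λ i → k (elem i) * h (x * elem i))        ≈⟨ Π.sum-cong-≋ {q} (λ i → k*h (elem i)) ⟩
    product (λ i → h (elem i) * x)                     ≈⟨ Π.∑-distrib-+ (h ∘ elem) (λ _ → x) ⟩
    P * product {q} (λ _ → x)                          ≈⟨ *-congˡ (Π.sum-replicate q) ⟩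
    P * x ^ q                                          ∎))
    where
    module Π = Sum *-commutativeMonoid

    cancel : ∀ {y z} → y * z ≈ 1# → ∀ w → y * (z * w) ≈ w
    cancel yz≈1 w = trans (sym (*-assoc _ _ _)) (trans (*-congʳ yz≈1) (*-identityˡ w))

    -- The enumeration includes 0. `h` replaces it by 1, so that P is the product of the units, and
    -- `k` supplies the factor `x` that is then missing at 0.
    h k : Carrier → Carrier
    h y with y ≈? 0#
    ... | yes _ = 1#
    ... | no  _ = y
    k y with y ≈? 0#
    ... | yes _ = x
    ... | no  _ = 1#

    h-cong : ∀ {y z} → y ≈ z → h y ≈ h z
    h-cong {y} {z} y≈z with y ≈? 0# | z ≈? 0#
    ... | yes _   | yes _   = refl
    ... | yes y≈0 | no z≉0  = ⊥-elim (z≉0 (trans (sym y≈z) y≈0))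
    ... | no y≉0  | yes z≈0 = ⊥-elim (y≉0 (trans y≈z z≈0))
    ... | no _    | no _    = y≈z

    h≉0 : ∀ y → ¬ (h y ≈ 0#)
    h≉0 y with y ≈? 0#
    ... | yes _  = 1≉0
    ... | no y≉0 = y≉0

    P = product (h ∘ elem)

    P≉0 : ¬ (P ≈ 0#)
    P≉0 = product-≉0 (h≉0 ∘ elem)

    k*h : ∀ y → k y * h (x * y) ≈ h y * x
    k*h y with y ≈? 0# | (x * y) ≈? 0#
    ... | yes _   | yes _    = *-comm _ _
    ... | yes y≈0 | no xy≉0  = ⊥-elim (xy≉0 (trans (*-congˡ y≈0) (zeroʳ x)))
    ... | no y≉0  | yes xy≈0 = ⊥-elim (*-≉0 x≉0 y≉0 xy≈0)
    ... | no _    | no _     = trans (*-identityˡ _) (*-comm _ _)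

    k-0 : ∀ y → y ≈ 0# → k y ≈ x
    k-0 y y≈0 with y ≈? 0#
    ... | yes _  = refl
    ... | no y≉0 = ⊥-elim (y≉0 y≈0)

    k-≉0 : ∀ y → ¬ (y ≈ 0#) → k y ≈ 1#
    k-≉0 y y≉0 with y ≈? 0#
    ... | yes y≈0 = ⊥-elim (y≉0 y≈0)
    ... | no _    = refl

    ∏k≈x : product (k ∘ elem) ≈ x
    ∏k≈x = trans
      (SumProperties.sum-single *-commutativeMonoid (from 0#) λ j j≢0 →
        k-≉0 (elem j) λ e → j≢0 (≡.trans (≡.sym (from-elem j)) (from-cong e)))
      (k-0 _ (elem-from 0#))

  -- If p·1 were a unit, so would be its e-th power q·1, which is 0.
  base×1≈0 : ∀ p e → q ≡ p ℕ.^ e → p × 1# ≈ 0#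
  base×1≈0 p e q≡p^e with (p × 1#) ≈? 0#
  ... | yes p≈0 = p≈0
  ... | no p≉0  = ⊥-elim (power e (trans (×-congˡ (≡.sym q≡p^e)) order×1≈0))
    where
    power : ∀ e → ¬ ((p ℕ.^ e) × 1# ≈ 0#)
    power zero    e≈0 = 1≉0 (trans (sym (+-identityʳ 1#)) e≈0)
    power (suc e) e≈0 = *-≉0 p≉0 (power e) (trans (sym (×1-homo-* p (p ℕ.^ e))) e≈0)

-- Rational exponents.

module RationalProperties where
  open import Data.Integer.Base as ℤ using (+_; ∣_∣)
  import Data.Integer.Properties as ℤ
  open import Data.Rational.Base hiding (∣_∣)
  open import Data.Rational.Properties
  open import Data.Rational.Unnormalised.Base as ℚᵘ using (mkℚᵘ; *≡*; *≤*)
  import Data.Rational.Unnormalised.Properties as ℚᵘ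
  open import Relation.Binary.PropositionalEquality

  ℕ→ℚ-suc : ∀ n → ℕ→ℚ (suc n) ≡ 1ℚ + ℕ→ℚ n
  ℕ→ℚ-suc n = toℚᵘ-injective (begin
    toℚᵘ (ℕ→ℚ (suc n))            ≈⟨ toℚᵘ-fromℚᵘ (mkℚᵘ (+ suc n) 0) ⟩
    mkℚᵘ (+ suc n) 0              ≈⟨ *≡* (cong (λ z → (+ 1 ℤ.+ z) ℤ.* + 1) (sym (ℤ.*-identityʳ (+ n)))) ⟩
    ℚᵘ.1ℚᵘ ℚᵘ.+ mkℚᵘ (+ n) 0      ≈⟨ ℚᵘ.+-congʳ ℚᵘ.1ℚᵘ (toℚᵘ-fromℚᵘ (mkℚᵘ (+ n) 0)) ⟨
    ℚᵘ.1ℚᵘ ℚᵘ.+ toℚᵘ (ℕ→ℚ n)      ≈⟨ toℚᵘ-homo-+ 1ℚ (ℕ→ℚ n) ⟨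
    toℚᵘ (1ℚ + ℕ→ℚ n)             ∎)
    where open ℚᵘ.≃-Reasoning

  -- The absolute value of the numerator serves as bound, as the denominator is at least 1.
  archimedean : ∀ r → ∃[ N ] (∀ n → N ℕ.≤ n → r ≤ ℕ→ℚ n)
  archimedean r@(mkℚ num d _) = ∣ num ∣ , λ n N≤n → toℚᵘ-cancel-≤ (begin
    toℚᵘ r               ≤⟨ *≤* (bound n N≤n) ⟩
    mkℚᵘ (+ n) 0         ≃⟨ toℚᵘ-fromℚᵘ (mkℚᵘ (+ n) 0) ⟨
    toℚᵘ (ℕ→ℚ n)         ∎)
    where
    open ℚᵘ.≤-Reasoning
    i≤∣i∣ : ∀ i → i ℤ.≤ + ∣ i ∣
    i≤∣i∣ (+ n)        = ℤ.≤-refl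
    i≤∣i∣ ℤ.-[1+ n ]   = ℤ.-≤+
    bound : ∀ n → ∣ num ∣ ℕ.≤ n → num ℤ.* + 1 ℤ.≤ + n ℤ.* + suc d
    bound n N≤n = ℤ.≤-trans (ℤ.≤-reflexive (ℤ.*-identityʳ num))
      (ℤ.≤-trans (i≤∣i∣ num) (ℤ.≤-trans (ℤ.+≤+ (ℕ.≤-trans N≤n (ℕ.m≤m*n n (suc d))))
        (ℤ.≤-reflexive (ℤ.pos-* n (suc d)))))

  s≰s-1 : ∀ s → ¬ (s ≤ s - 1ℚ)
  s≰s-1 s s≤s-1 = <-irrefl refl (<-≤-trans s-1<s s≤s-1)
    where
    s-1<s : s - 1ℚ < s
    s-1<s = subst (s - 1ℚ <_) (+-identityʳ s) (+-monoʳ-< s (neg-antimono-< (positive⁻¹ 1ℚ)))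

  s-t≤r : ∀ s t r → s - r ≤ t → s - t ≤ r
  s-t≤r s t r s-r≤t = begin
    s - t                ≡⟨ cong (_- t) (+-identityʳ s) ⟨
    (s + 0ℚ) - t         ≡⟨ cong (λ z → (s + z) - t) (+-inverseˡ r) ⟨
    (s + (- r + r)) - t  ≡⟨ cong (_- t) (+-assoc s (- r) r) ⟨
    ((s - r) + r) - t    ≤⟨ +-monoˡ-≤ (- t) (+-monoˡ-≤ r s-r≤t) ⟩
    (t + r) - t          ≡⟨ cong (_- t) (+-comm t r) ⟩
    (r + t) - t          ≡⟨ +-assoc r t (- t) ⟩
    r + (t - t)          ≡⟨ cong (λ z → r + z) (+-inverseʳ t) ⟩
    r + 0ℚ               ≡⟨ +-identityʳ r ⟩
    r                    ∎
    where open ≤-Reasoning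

-- The absolute value of ℂ∞.

module Valuation {a ℓ₁ c ℓ₂ q} {𝔽q : FiniteField a ℓ₁ q} (ℂ∞ : Cinf 𝔽q c ℓ₂) where
  private
    module 𝔽  = FiniteField 𝔽q
    module 𝔽P = FieldProperties 𝔽.fld
  open Cinf ℂ∞ hiding (zero)
  open FieldProperties fld
  open RationalProperties
  module ι = RingMorphisms.IsRingHomomorphism ι-hom
  open import Algebra.Properties.Ring ring using (-1*x≈-x)
  open import Data.Rational.Base as ℚ using (ℚ; 0ℚ; 1ℚ)
  import Data.Rational.Properties as ℚ
  open import Data.Sum.Base using (inj₁; inj₂)
  open import Data.Vec.Base using ([]; _∷_)
  open import Relation.Binary.Construct.Add.Infimum.NonStrict ℚ._≤_
    using (⊥₋≤_; [_]; [≤]-injective; ≤₋-trans; ≤₋-reflexive-≡)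
  open import Relation.Nullary.Construct.Add.Infimum using (⊥₋; [_])

  infix 4 _≼_

  -- Comparing two elements rather than an element with a number keeps rational exponents out of
  -- nearly all later estimates.
  _≼_ : Carrier → Carrier → Set
  x ≼ y = log∣ x ∣ ≤₋ log∣ y ∣

  ≼-trans : ∀ {x y z} → x ≼ y → y ≼ z → x ≼ z
  ≼-trans = ≤₋-trans ℚ.≤-trans

  ≼-reflexive : ∀ {x y} → x ≈ y → x ≼ y
  ≼-reflexive x≈y = ≤₋-reflexive-≡ ℚ.≤-reflexive (log-cong x≈y)

  ≼-refl : ∀ {x} → x ≼ x
  ≼-refl = ≼-reflexive refl

  ≼-respˡ : ∀ {x x′ y} → x′ ≈ x → x ≼ y → x′ ≼ y
  ≼-respˡ e = ≼-trans (≼-reflexive e)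

  ≼-respʳ : ∀ {x y y′} → y ≈ y′ → x ≼ y → x ≼ y′
  ≼-respʳ e x≼y = ≼-trans x≼y (≼-reflexive e)

  log-0≡⊥ : ∀ {x} → x ≈ 0# → log∣ x ∣ ≡ ⊥₋
  log-0≡⊥ = Equivalence.from (log-0 _)

  -- The logarithm tells zero from nonzero by its constructor, so this test is available although ℂ∞
  -- comes without decidable equality.
  _≈0? : ∀ x → Dec (x ≈ 0#)
  x ≈0? with log∣ x ∣ in eq
  ... | ⊥₋    = yes (Equivalence.to (log-0 x) eq)
  ... | [ _ ] = no λ x≈0 → case (≡.trans (≡.sym eq) (log-0≡⊥ x≈0))
    where
    case : ∀ {r} → ¬ ([ r ] ≡ ⊥₋)
    case ()

  log-≉0 : ∀ {x} → ¬ (x ≈ 0#) → ∃[ s ] log∣ x ∣ ≡ [ s ]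
  log-≉0 {x} x≉0 with log∣ x ∣ in eq
  ... | ⊥₋    = ⊥-elim (x≉0 (Equivalence.to (log-0 x) eq))
  ... | [ s ] = s , ≡.refl

  0≼ : ∀ {x y} → x ≈ 0# → x ≼ y
  0≼ {x} {y} x≈0 = ≡.subst (_≤₋ log∣ y ∣) (≡.sym (log-0≡⊥ x≈0)) (⊥₋≤ _)

  +₋-mono : ∀ {k l m n} → k ≤₋ l → m ≤₋ n → (k +₋ m) ≤₋ (l +₋ n)
  +₋-mono         (⊥₋≤ l) q        = ⊥₋≤ _
  +₋-mono {[ _ ]} [ p ]   (⊥₋≤ n)  = ⊥₋≤ _
  +₋-mono         [ p ]   [ q ]    = [ ℚ.+-mono-≤ p q ]

  *-mono-≼ : ∀ {w x y z} → w ≼ x → y ≼ z → w * y ≼ x * z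
  *-mono-≼ {w} {x} {y} {z} w≼x y≼z =
    ≡.subst₂ _≤₋_ (≡.sym (log-* w y)) (≡.sym (log-* x z)) (+₋-mono w≼x y≼z)

  ^-mono-≼ : ∀ n {x y} → x ≼ y → x ^ n ≼ y ^ n
  ^-mono-≼ zero    x≼y = ≼-refl
  ^-mono-≼ (suc n) x≼y = *-mono-≼ x≼y (^-mono-≼ n x≼y)

  log-+-≤ : ∀ {x y l} → log∣ x ∣ ≤₋ l → log∣ y ∣ ≤₋ l → log∣ x + y ∣ ≤₋ l
  log-+-≤ {x} {y} x≤l y≤l with log-+ x y
  ... | inj₁ x+y≤x = ≤₋-trans ℚ.≤-trans x+y≤x x≤l
  ... | inj₂ x+y≤y = ≤₋-trans ℚ.≤-trans x+y≤y y≤l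

  +-≼ : ∀ {x y z} → x ≼ z → y ≼ z → x + y ≼ z
  +-≼ = log-+-≤

  log-ι : ∀ {b} → ¬ (b 𝔽.≈ 𝔽.0#) → log∣ ι b ∣ ≡ [ 0ℚ ]
  log-ι {b} b≉0 = ≡.trans (log-cong (solve 2 (λ b t → b := b :+ t :* 𝟘) refl (ι b) θ)) (log-degree [] b b≉0)

  ι-×≈0 : ∀ n → n 𝔽P.× 𝔽.1# 𝔽.≈ 𝔽.0# → n × 1# ≈ 0#
  ι-×≈0 n n≈0 = trans (ι-× n) (trans (ι.⟦⟧-cong n≈0) ι.0#-homo)
    where
    ι-× : ∀ n → n × 1# ≈ ι (n 𝔽P.× 𝔽.1#)
    ι-× zero    = sym ι.0#-homo
    ι-× (suc n) = trans (+-cong (sym ι.1#-homo) (ι-× n)) (sym (ι.+-homo 𝔽.1# (n 𝔽P.× 𝔽.1#)))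

  log-1 : log∣ 1# ∣ ≡ [ 0ℚ ]
  log-1 = ≡.trans (log-cong (sym ι.1#-homo)) (log-ι 𝔽.1≉0)

  -- -1 is the image of a nonzero constant of 𝔽_q, hence has absolute value 1.
  log-neg : ∀ x → log∣ - x ∣ ≡ log∣ x ∣
  log-neg x = begin
    log∣ - x ∣                  ≡⟨ log-cong (-1*x≈-x x) ⟨
    log∣ - 1# * x ∣             ≡⟨ log-* (- 1#) x ⟩
    log∣ - 1# ∣ +₋ log∣ x ∣     ≡⟨ ≡.cong (_+₋ log∣ x ∣) log-[-1] ⟩
    [ 0ℚ ] +₋ log∣ x ∣          ≡⟨ identity log∣ x ∣ ⟩
    log∣ x ∣                    ∎
    where
    open ≡.≡-Reasoning
    identity : ∀ l → [ 0ℚ ] +₋ l ≡ l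
    identity ⊥₋    = ≡.refl
    identity [ s ] = ≡.cong [_] (ℚ.+-identityˡ s)
    log-[-1] : log∣ - 1# ∣ ≡ [ 0ℚ ]
    log-[-1] = ≡.trans (log-cong (trans (-‿cong (sym ι.1#-homo)) (sym (ι.-‿homo 𝔽.1#)))) (log-ι (𝔽P.-‿≉0 𝔽.1≉0))

  -‿≼ : ∀ {x y} → x ≼ y → - x ≼ y
  -‿≼ {x} {y} = ≡.subst (_≤₋ log∣ y ∣) (≡.sym (log-neg x))

  -≼ : ∀ {x y z} → x ≼ z → y ≼ z → x - y ≼ z
  -≼ x≼z y≼z = +-≼ x≼z (-‿≼ y≼z)

  log-θ : log∣ θ ∣ ≡ [ 1ℚ ]
  log-θ = ≡.trans (log-cong (sym (begin
    ι 𝔽.0# + θ * (ι 𝔽.1# + θ * 0#)  ≈⟨ +-cong ι.0#-homo (*-congˡ (+-congʳ ι.1#-homo)) ⟩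
    0# + θ * (1# + θ * 0#)          ≈⟨ solve 1 (λ t → 𝟘 :+ t :* (𝟙 :+ t :* 𝟘) := t) refl θ ⟩
    θ                               ∎))) (log-degree (𝔽.0# ∷ []) 𝔽.1# 𝔽.1≉0)
    where
    open import Relation.Binary.Reasoning.Setoid setoid

  ≉0-log : ∀ {x s} → log∣ x ∣ ≡ [ s ] → ¬ (x ≈ 0#)
  ≉0-log {x} eq x≈0 with ≡.trans (≡.sym eq) (log-0≡⊥ x≈0)
  ... | ()

  θ≉0 : ¬ (θ ≈ 0#)
  θ≉0 = ≉0-log log-θ

  u : Carrier
  u = θ ⁻¹

  θ*u≈1 : θ * u ≈ 1#
  θ*u≈1 = *-inverseʳ θ θ≉0

  u≉0 : ¬ (u ≈ 0#)
  u≉0 = ⁻¹-≉0 θ≉0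

  log-u^ : ∀ n → log∣ u ^ n ∣ ≡ [ ℚ.- ℕ→ℚ n ]
  log-u^ zero    = log-1
  log-u^ (suc n) with log-≉0 u≉0
  ... | s , log-u≡s = begin
    log∣ u * u ^ n ∣             ≡⟨ log-* u (u ^ n) ⟩
    log∣ u ∣ +₋ log∣ u ^ n ∣     ≡⟨ ≡.cong₂ _+₋_ log-u≡s (log-u^ n) ⟩
    [ s ℚ.+ ℚ.- ℕ→ℚ n ]          ≡⟨ ≡.cong (λ z → [ z ℚ.+ ℚ.- ℕ→ℚ n ]) s≡-1 ⟩
    [ ℚ.- 1ℚ ℚ.+ ℚ.- ℕ→ℚ n ]     ≡⟨ ≡.cong [_] (ℚ.neg-distrib-+ 1ℚ (ℕ→ℚ n)) ⟨
    [ ℚ.- (1ℚ ℚ.+ ℕ→ℚ n) ]       ≡⟨ ≡.cong (λ z → [ ℚ.- z ]) (ℕ→ℚ-suc n) ⟨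
    [ ℚ.- ℕ→ℚ (suc n) ]          ∎
    where
    open ≡.≡-Reasoning
    [1+s]≡[0] : [ 1ℚ ℚ.+ s ] ≡ [ 0ℚ ]
    [1+s]≡[0] = ≡.trans (≡.cong₂ _+₋_ (≡.sym log-θ) (≡.sym log-u≡s))
                  (≡.trans (≡.sym (log-* θ u)) (≡.trans (log-cong θ*u≈1) log-1))
    []-inj : ∀ {p q : ℚ} → [ p ] ≡ [ q ] → p ≡ q
    []-inj ≡.refl = ≡.refl
    s≡-1 : s ≡ ℚ.- 1ℚ
    s≡-1 = begin
      s                        ≡⟨ ℚ.+-identityˡ s ⟨
      (ℚ.- 1ℚ ℚ.+ 1ℚ) ℚ.+ s    ≡⟨ ℚ.+-assoc (ℚ.- 1ℚ) 1ℚ s ⟩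
      ℚ.- 1ℚ ℚ.+ (1ℚ ℚ.+ s)    ≡⟨ ≡.cong (ℚ.- 1ℚ ℚ.+_) ([]-inj [1+s]≡[0]) ⟩
      ℚ.- 1ℚ                   ∎

  -- `x ≼ y * u` stands for strict inequality; this is its irreflexivity, and all contradictions
  -- between sizes end here.
  small-absurd : ∀ {x} → ¬ (x ≈ 0#) → ¬ (x ≼ x * u)
  small-absurd {x} x≉0 x≼xu with log-≉0 x≉0
  ... | s , log-x≡s = s≰s-1 s ([≤]-injective (≡.subst₂ _≤₋_ log-x≡s
    (≡.trans (log-* x u) (≡.cong₂ _+₋_ log-x≡s
      (≡.trans (log-cong (sym (*-identityʳ u))) (log-u^ 1)))) x≼xu))

  eventually-small : ∀ C r → ∃[ N ] (∀ n → N ℕ.≤ n → log∣ C * u ^ n ∣ ≤₋ [ r ])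
  eventually-small C r with C ≈0?
  ... | yes C≈0 = 0 , λ n _ → ≡.subst (_≤₋ [ r ]) (≡.sym (log-0≡⊥ (trans (*-congʳ C≈0) (zeroˡ _)))) (⊥₋≤ _)
  ... | no C≉0 with log-≉0 C≉0
  ...   | s , log-C≡s with archimedean (s ℚ.- r)
  ...     | N , bound = N , λ n N≤n →
    ≡.subst (_≤₋ [ r ]) (≡.sym (≡.trans (log-* C (u ^ n)) (≡.cong₂ _+₋_ log-C≡s (log-u^ n))))
      [ s-t≤r s (ℕ→ℚ n) r (bound n N≤n) ]

  arbitrarily-small⇒0 : ∀ {x} → (∀ r → log∣ x ∣ ≤₋ [ r ]) → x ≈ 0#
  arbitrarily-small⇒0 {x} small with x ≈0?
  ... | yes x≈0 = x≈0
  ... | no x≉0 = ⊥-elim (small-absurd x≉0 (x≼xu (log-≉0 (*-≉0 x≉0 u≉0))))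
    where
    -- The bound to be beaten is the logarithm of `x * u` itself.
    x≼xu : ∃[ s ] log∣ x * u ∣ ≡ [ s ] → x ≼ x * u
    x≼xu (s , eq) = ≡.subst (log∣ x ∣ ≤₋_) (≡.sym eq) (small s)

  u≼1 : u ≼ 1#
  u≼1 = ≡.subst₂ _≤₋_ (≡.trans (≡.sym (log-u^ 1)) (log-cong (*-identityʳ u))) (≡.sym log-1)
          [ ℚ.<⇒≤ (ℚ.neg-antimono-< (ℚ.positive⁻¹ 1ℚ)) ]

  u^n≼1 : ∀ n → u ^ n ≼ 1#
  u^n≼1 n = ≼-respʳ (1^n≈1 n) (^-mono-≼ n u≼1)

  u^-antimono : ∀ {m n} → m ℕ.≤ n → u ^ n ≼ u ^ m
  u^-antimono {n = n} z≤n = u^n≼1 n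
  u^-antimono (s≤s m≤n)   = *-mono-≼ ≼-refl (u^-antimono m≤n)

  *-≼1 : ∀ {x y z} → x ≼ z → y ≼ 1# → x * y ≼ z
  *-≼1 x≼z y≼1 = ≼-respʳ (*-identityʳ _) (*-mono-≼ x≼z y≼1)

  -- Limits with explicit rates.

  ⟶-unique : ∀ {f x y} → f ⟶ x → f ⟶ y → x ≈ y
  ⟶-unique {f} {x} {y} f⟶x f⟶y = x-y≈0⇒x≈y (arbitrarily-small⇒0 λ r →
    let M , f-x = f⟶x r; N , f-y = f⟶y r; n = M ℕ.⊔ N in
    ≡.subst (_≤₋ [ r ]) (log-cong (solve 3 (λ f x y → (f :- y) :+ :- (f :- x) := x :- y) refl (f n) x y))
      (log-+-≤ (f-y n (ℕ.m≤n⊔m M N))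
               (≡.subst (_≤₋ [ r ]) (≡.sym (log-neg (f n - x))) (f-x n (ℕ.m≤m⊔n M N)))))

  ⟶⇒lim : ∀ {f x} → f ⟶ x → lim f ≈ x
  ⟶⇒lim {f} {x} f⟶x = ⟶-unique (lim-converges f cauchy) f⟶x
    where
    cauchy : Cauchy f
    cauchy r with f⟶x r
    ... | N , f-x = N , λ m n N≤m N≤n →
      ≡.subst (_≤₋ [ r ]) (log-cong (solve 3 (λ f g x → (f :- x) :+ :- (g :- x) := f :- g) refl (f m) (f n) x))
        (log-+-≤ (f-x m N≤m) (≡.subst (_≤₋ [ r ]) (≡.sym (log-neg (f n - x))) (f-x n N≤n)))

  rate⇒⟶ : ∀ f {x} C → (∀ n → f n - x ≼ C * u ^ n) → f ⟶ x
  rate⇒⟶ f C rate r with eventually-small C r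
  ... | N , small = N , λ n N≤n → ≤₋-trans ℚ.≤-trans (rate n) (small n N≤n)

  rate⇒lim : ∀ f {x} C → (∀ n → f (suc n) - x ≼ C * u ^ n) → lim f ≈ x
  rate⇒lim f C rate = ⟶⇒lim λ r → let N , f-x = rate⇒⟶ (λ n → f (suc n)) C rate r in suc N , λ where
    (suc n) (s≤s N≤n) → f-x n N≤n

  rate-unique : ∀ f {x y} C D → (∀ n → f n - x ≼ C * u ^ n) → (∀ n → f n - y ≼ D * u ^ n) → x ≈ y
  rate-unique f C D f-x f-y = ⟶-unique (rate⇒⟶ f C f-x) (rate⇒⟶ f D f-y)

  -- By the ultrametric inequality a sum of steps is bounded by the largest of their bounds, which
  -- is that of the first step.
  rate-steps : ∀ (f : ℕ → Carrier) C → (∀ n → f (suc n) - f n ≼ C * u ^ n) →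
               ∀ {m n} → n ℕ.≤′ m → f m - f n ≼ C * u ^ n
  rate-steps f C step {n = n} ℕ.≤′-refl = 0≼ (-‿inverseʳ (f n))
  rate-steps f C step {suc m} {n} (ℕ.≤′-step n≤m) =
    ≼-respˡ (solve 3 (λ x y z → x :- z := (x :- y) :+ (y :- z)) refl (f (suc m)) (f m) (f n))
      (+-≼ (≼-trans (step m) (*-mono-≼ ≼-refl (u^-antimono (ℕ.≤′⇒≤ n≤m)))) (rate-steps f C step n≤m))

  steps⇒Cauchy : ∀ (f : ℕ → Carrier) C → (∀ n → f (suc n) - f n ≼ C * u ^ n) → Cauchy f
  steps⇒Cauchy f C step r with eventually-small C r
  ... | N , small = N , λ m n N≤m N≤n → ≤₋-trans ℚ.≤-trans
    (≼-respˡ (solve 3 (λ f g x → f :- g := (f :- x) :- (g :- x)) refl (f m) (f n) (f N))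
      (-≼ (rate-steps f C step (ℕ.≤⇒≤′ N≤m)) (rate-steps f C step (ℕ.≤⇒≤′ N≤n))))
    (small N ℕ.≤-refl)

  -- `f n - lim f` is compared with `f m - f n` for a late `m`. As `C` is nonzero, `C * u ^ n` has a
  -- finite logarithm `s`, and that is the precision asked of the convergence.
  lim-rate : ∀ (f : ℕ → Carrier) C → ¬ (C ≈ 0#) → (∀ n → f (suc n) - f n ≼ C * u ^ n) →
             ∀ n → f n - lim f ≼ C * u ^ n
  lim-rate f C C≉0 step n =
    let s , eq = log-≉0 (*-≉0 C≉0 (^-≉0 n u≉0))
        N , near = lim-converges f (steps⇒Cauchy f C step) s
        m = n ℕ.⊔ N
    in ≼-respˡ (solve 3 (λ f g x → f :- x := (g :- x) :- (g :- f)) refl (f n) (f m) (lim f))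
         (-≼ (≡.subst (log∣ f m - lim f ∣ ≤₋_) (≡.sym eq) (near m (ℕ.m≤n⊔m n N)))
             (rate-steps f C step (ℕ.≤⇒≤′ (ℕ.m≤m⊔n n N))))

  -- The ultrametric inequality for 1 = (1 - ε) + ε; its other alternative, |1| ≤ |ε|, contradicts
  -- |ε| ≤ |u|.
  1≼1-ε : ∀ {ε} → ε ≼ u → 1# ≼ 1# - ε
  1≼1-ε {ε} ε≼u with log-+ (1# - ε) ε
  ... | inj₁ le = ≼-respˡ (solve 1 (λ e → 𝟙 := 𝟙 :- e :+ e) refl ε) le
  ... | inj₂ le = ⊥-elim (small-absurd 1≉0 (≼-respʳ (sym (*-identityˡ u))
                    (≼-trans (≼-respˡ (solve 1 (λ e → 𝟙 := 𝟙 :- e :+ e) refl ε) le) ε≼u)))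

  1-ε≉0 : ∀ {ε} → ε ≼ u → ¬ (1# - ε ≈ 0#)
  1-ε≉0 {ε} ε≼u e = small-absurd 1≉0 (≼-trans (1≼1-ε ε≼u) (0≼ e))

  [1-ε]⁻¹≼1 : ∀ {ε} → ε ≼ u → (1# - ε) ⁻¹ ≼ 1#
  [1-ε]⁻¹≼1 {ε} ε≼u = ≼-respˡ (sym (*-identityˡ _))
    (≼-respʳ (*-inverseʳ _ (1-ε≉0 ε≼u)) (*-mono-≼ (1≼1-ε ε≼u) ≼-refl))

  -- The left side is ε (1 - ε)⁻¹, and the inverse has absolute value at most 1.
  [1-ε]⁻¹-1≼ε : ∀ {ε} → ε ≼ u → (1# - ε) ⁻¹ - 1# ≼ ε
  [1-ε]⁻¹-1≼ε {ε} ε≼u = ≼-respˡ (*-cancelˡ (1-ε≉0 ε≼u) (begin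
    (1# - ε) * ((1# - ε) ⁻¹ - 1#)   ≈⟨ solve 2 (λ x y → x :* (y :- 𝟙) := x :* y :- x) refl _ _ ⟩
    (1# - ε) * (1# - ε) ⁻¹ - (1# - ε) ≈⟨ +-congʳ x*x⁻¹≈1 ⟩
    1# - (1# - ε)                   ≈⟨ solve 1 (λ e → 𝟙 :- (𝟙 :- e) := 𝟙 :* e) refl ε ⟩
    1# * ε                          ≈⟨ *-congʳ x*x⁻¹≈1 ⟨
    (1# - ε) * (1# - ε) ⁻¹ * ε      ≈⟨ solve 3 (λ x y z → x :* y :* z := x :* (z :* y)) refl (1# - ε) ((1# - ε) ⁻¹) ε ⟩
    (1# - ε) * (ε * (1# - ε) ⁻¹)    ∎)) (*-≼1 ≼-refl ([1-ε]⁻¹≼1 ε≼u))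
    where
    open import Relation.Binary.Reasoning.Setoid setoid
    x*x⁻¹≈1 = *-inverseʳ _ (1-ε≉0 ε≼u)

-- Carlitz polynomials and the sums of a(t)/a over monic a of fixed degree.

module PowerSums {a ℓ₁ c ℓ₂ q} {𝔽q : FiniteField a ℓ₁ q} (ℂ∞ : Cinf 𝔽q c ℓ₂) (1<q : 1 ℕ.< q)
  (+-^q : FieldProperties.AdditivePower (Cinf.fld ℂ∞) q)
  where
  private module 𝔽 = FiniteField 𝔽q
  open Cinf ℂ∞ hiding (zero)
  open Carlitz ℂ∞ using (∑𝔽^; [_]q; ∑<)
  open Polynomial 𝔽.fld using (coeff; monic)
  open FieldProperties fld
  open FiniteFieldProperties 𝔽q
    using (elem; elem-injective; ^-order; order×1≈0; order-nonZero) renaming (_≈?_ to _≟𝔽_)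
  open Valuation ℂ∞
  open import Data.Vec.Base using (Vec; []; _∷_; toList; _∷ʳ_)
  open import Relation.Binary.Reasoning.Setoid setoid
  open import Algebra.Properties.CommutativeMonoid.Sum +-commutativeMonoid using (∑-comm)

  instance
    q-nonZero : ℕ.NonZero q
    q-nonZero = order-nonZero

  0^q≈0 : 0# ^ q ≈ 0#
  0^q≈0 = 0^n≈0 q

  -- Additivity applied to `x - x` gives the sign without a case distinction on the parity of q.
  -‿^q : ∀ x → (- x) ^ q ≈ - (x ^ q)
  -‿^q x = x-y≈0⇒x≈y (begin
    (- x) ^ q - - (x ^ q)    ≈⟨ solve 2 (λ x y → x :- (:- y) := y :+ x) refl _ _ ⟩
    x ^ q + (- x) ^ q        ≈⟨ +-^q x (- x) ⟨
    (x - x) ^ q              ≈⟨ ^-congˡ q (-‿inverseʳ x) ⟩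
    0# ^ q                   ≈⟨ 0^q≈0 ⟩
    0#                       ∎)

  sub-^q : ∀ x y → (x - y) ^ q ≈ x ^ q - y ^ q
  sub-^q x y = trans (+-^q x (- y)) (+-congˡ (-‿^q y))

  ^q^-suc : ∀ x n → x ^ (q ℕ.^ suc n) ≈ (x ^ (q ℕ.^ n)) ^ q
  ^q^-suc x n = trans (^-congʳ x (ℕ.*-comm q (q ℕ.^ n))) (sym (^-assocʳ x (q ℕ.^ n) q))

  sub-^q^ : ∀ n x y → (x - y) ^ (q ℕ.^ n) ≈ x ^ (q ℕ.^ n) - y ^ (q ℕ.^ n)
  sub-^q^ zero    x y = solve 2 (λ x y → (x :- y) :* 𝟙 := x :* 𝟙 :- y :* 𝟙) refl x y
  sub-^q^ (suc n) x y = begin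
    (x - y) ^ (q ℕ.^ suc n)                      ≈⟨ ^q^-suc _ n ⟩
    ((x - y) ^ (q ℕ.^ n)) ^ q                    ≈⟨ ^-congˡ q (sub-^q^ n x y) ⟩
    (x ^ (q ℕ.^ n) - y ^ (q ℕ.^ n)) ^ q          ≈⟨ sub-^q _ _ ⟩
    (x ^ (q ℕ.^ n)) ^ q - (y ^ (q ℕ.^ n)) ^ q    ≈⟨ +-cong (^q^-suc x n) (-‿cong (^q^-suc y n)) ⟨
    x ^ (q ℕ.^ suc n) - y ^ (q ℕ.^ suc n)        ∎

  ι-^ : ∀ b n → ι b ^ n ≈ ι (b 𝔽.^ n)
  ι-^ b zero    = sym ι.1#-homo
  ι-^ b (suc n) = trans (*-congˡ (ι-^ b n)) (sym (ι.*-homo b (b 𝔽.^ n)))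

  ι-^q : ∀ b → ι b ^ q ≈ ι b
  ι-^q b = trans (ι-^ b q) (ι.⟦⟧-cong (^-order b))

  ι-injective : ∀ {b b′} → ι b ≈ ι b′ → b 𝔽.≈ b′
  ι-injective {b} {b′} e with (b 𝔽.- b′) ≟𝔽 𝔽.0#
  ... | yes b-b′≈0 = FieldProperties.x-y≈0⇒x≈y 𝔽.fld b-b′≈0
  ... | no b-b′≉0  = ⊥-elim (≉0-log (log-ι b-b′≉0) (begin
    ι (b 𝔽.- b′)       ≈⟨ ι.+-homo b (𝔽.- b′) ⟩
    ι b + ι (𝔽.- b′)   ≈⟨ +-congˡ (ι.-‿homo b′) ⟩
    ι b - ι b′         ≈⟨ x≈y⇒x-y≈0 e ⟩
    0#                 ∎))

  order×x≈0 : ∀ x → q × x ≈ 0#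
  order×x≈0 = n×x≈0 q (ι-×≈0 q order×1≈0)

  sum-⁻¹ : ∀ y → ¬ (y ^ q - y ≈ 0#) → sum (λ i → (y + ι (elem i)) ⁻¹) ≈ - (y ^ q - y) ⁻¹
  sum-⁻¹ y y^q≉y = begin
    sum (λ i → (y + ι (elem i)) ⁻¹)          ≈⟨ sum-cong-≋ {q} (λ i → ⁻¹-cong (+-congˡ (y≈--y (ι (elem i))))) ⟩
    sum (λ i → (y - - ι (elem i)) ⁻¹)        ≈⟨ partialFractions (order×x≈0 1#) (λ i → - ι (elem i))
                                                 (λ e → elem-injective (ι-injective (trans (y≈--y _) (trans (-‿cong e) (sym (y≈--y _))))))
                                                 (λ i → trans (-‿^q _) (-‿cong (ι-^q (elem i)))) y y^q≉y ⟩
    - (y ^ q - y) ⁻¹                         ∎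
    where
    y≈--y : ∀ y → y ≈ - - y
    y≈--y = solve 1 (λ y → y := :- (:- y)) refl

  n<q^n : ∀ n → n ℕ.< q ℕ.^ n
  n<q^n zero    = s≤s z≤n
  n<q^n (suc n) = ℕ.≤-<-trans (n<q^n n)
    (ℕ.<-≤-trans (ℕ.m<m*n (q ℕ.^ n) q {{ℕ.m^n≢0 q n}} 1<q) (ℕ.≤-reflexive (ℕ.*-comm (q ℕ.^ n) q)))

  -- This is θ^{1 - q^{n+1}}, the relative error in [n+1] ≈ θ^{q^{n+1}}; the factors of the product
  -- for π̃ are the inverses of `1# - ε n`.
  ε : ℕ → Carrier
  ε n = u ^ (q ℕ.^ suc n ℕ.∸ 1)

  ε≼u^ : ∀ n → ε n ≼ u ^ suc n
  ε≼u^ n = u^-antimono (ℕ.<⇒≤pred (n<q^n (suc n)))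

  ε≼u : ∀ n → ε n ≼ u
  ε≼u n = ≼-trans (ε≼u^ n) (*-≼1 ≼-refl (u^n≼1 n))

  θ^n*u^n≈1 : ∀ n → θ ^ n * u ^ n ≈ 1#
  θ^n*u^n≈1 n = trans (sym (^-distrib-* θ u n)) (trans (^-congˡ n θ*u≈1) (1^n≈1 n))

  [n]≈θ^*[1-ε] : ∀ n → [ suc n ]q ≈ θ ^ (q ℕ.^ suc n) * (1# - ε n)
  -- The bound excludes the exponent 0; for `suc Q` the truncated subtraction in `ε` computes.
  [n]≈θ^*[1-ε] n with q ℕ.^ suc n | n<q^n (suc n)
  ... | suc Q | _ = begin
    θ * θ ^ Q - θ                            ≈⟨ solve 2 (λ t x → t :* x :- t := t :* x :- t :* 𝟙) refl θ (θ ^ Q) ⟩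
    θ * θ ^ Q - θ * 1#                       ≈⟨ +-congˡ (-‿cong (*-congˡ (θ^n*u^n≈1 Q))) ⟨
    θ * θ ^ Q - θ * (θ ^ Q * u ^ Q)          ≈⟨ solve 3 (λ t x y → t :* x :- t :* (x :* y) := t :* x :* (𝟙 :- y)) refl θ (θ ^ Q) (u ^ Q) ⟩
    θ * θ ^ Q * (1# - u ^ Q)                 ∎

  [_]≉0 : ∀ n → ¬ ([ suc n ]q ≈ 0#)
  [ n ]≉0 e = *-≉0 (^-≉0 (q ℕ.^ suc n) θ≉0) (1-ε≉0 (ε≼u n)) (trans (sym ([n]≈θ^*[1-ε] n)) e)

  -- E k is Carlitz's e_k / D_k: the 𝔽_q-linear polynomial which vanishes on
  -- the polynomials in θ of degree less than k and is 1 at θ^k.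
  E : ℕ → Carrier → Carrier
  E zero    x = x
  E (suc k) x = (E k x ^ q - E k x) * [ suc k ]q ⁻¹

  [k]*E : ∀ k x → [ suc k ]q * E (suc k) x ≈ E k x ^ q - E k x
  [k]*E k x = begin
    D * (y * D ⁻¹)   ≈⟨ solve 3 (λ x y z → x :* (y :* z) := x :* z :* y) refl D y (D ⁻¹) ⟩
    D * D ⁻¹ * y     ≈⟨ *-congʳ (*-inverseʳ D ([ k ]≉0)) ⟩
    1# * y           ≈⟨ *-identityˡ y ⟩
    y                ∎
    where
    D = [ suc k ]q
    y = E k x ^ q - E k x

  E-linear : ∀ k x b y → E k (x + ι b * y) ≈ E k x + ι b * E k y
  E-linear zero    x b y = refl
  E-linear (suc k) x b y = trans (*-congʳ (begin
    E k (x + ι b * y) ^ q - E k (x + ι b * y)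
      ≈⟨ +-cong (^-congˡ q (E-linear k x b y)) (-‿cong (E-linear k x b y)) ⟩
    (X + ι b * Y) ^ q - (X + ι b * Y)
      ≈⟨ +-congʳ (trans (+-^q X (ι b * Y)) (+-congˡ (trans (^-distrib-* (ι b) Y q) (*-congʳ (ι-^q b))))) ⟩
    X ^ q + ι b * Y ^ q - (X + ι b * Y)
      ≈⟨ solve 5 (λ X Y b X′ Y′ → X′ :+ b :* Y′ :- (X :+ b :* Y) := (X′ :- X) :+ b :* (Y′ :- Y))
           refl X Y (ι b) (X ^ q) (Y ^ q) ⟩
    (X ^ q - X) + ι b * (Y ^ q - Y) ∎))
    (solve 4 (λ x b y z → (x :+ b :* y) :* z := x :* z :+ b :* (y :* z)) refl _ _ _ _)
    where
    X = E k x
    Y = E k y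

  E-pred : ℕ → Carrier → Carrier
  E-pred zero    x = 0#
  E-pred (suc k) x = E k x

  E-pred-^q : ∀ k x → E-pred k x ^ q - E-pred k x ≈ [ k ]q * E k x
  E-pred-^q zero x = begin
    0# ^ q - 0#              ≈⟨ +-congʳ 0^q≈0 ⟩
    0# - 0#                  ≈⟨ solve 2 (λ t x → 𝟘 :- 𝟘 := (t :* 𝟙 :- t) :* x) refl θ x ⟩
    (θ * 1# - θ) * x         ∎
  E-pred-^q (suc k) x = sym ([k]*E k x)

  -- After multiplication by [k+1] the claim is the case k raised to the q-th power minus that case
  -- itself. `E-pred-^q` turns W^q - W into [k] X, and the remaining multiples of X combine to [k+1]
  -- X.
  E-θ* : ∀ k x → E k (θ * x) ≈ θ ^ (q ℕ.^ k) * E k x + E-pred k x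
  E-θ* zero    x = solve 2 (λ t x → t :* x := t :* 𝟙 :* x :+ 𝟘) refl θ x
  E-θ* (suc k) x = *-cancelˡ [ k ]≉0 (begin
    [ suc k ]q * E (suc k) (θ * x)
      ≈⟨ [k]*E k (θ * x) ⟩
    E k (θ * x) ^ q - E k (θ * x)
      ≈⟨ +-cong (^-congˡ q (E-θ* k x)) (-‿cong (E-θ* k x)) ⟩
    (Q * X + W) ^ q - (Q * X + W)
      ≈⟨ +-congʳ (trans (+-^q _ _) (+-congʳ (trans (^-distrib-* Q X q) (*-congʳ (sym (^q^-suc θ k)))))) ⟩
    Q′ * X ^ q + W ^ q - (Q * X + W)
      ≈⟨ solve 6 (λ Q X W Q′ X′ W′ → Q′ :* X′ :+ W′ :- (Q :* X :+ W) := Q′ :* X′ :+ (W′ :- W) :- Q :* X)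
           refl Q X W Q′ (X ^ q) (W ^ q) ⟩
    Q′ * X ^ q + (W ^ q - W) - Q * X
      ≈⟨ +-congʳ (+-congˡ (E-pred-^q k x)) ⟩
    Q′ * X ^ q + (Q - θ) * X - Q * X
      ≈⟨ solve 5 (λ Q X Q′ X′ t → Q′ :* X′ :+ (Q :- t) :* X :- Q :* X :=
                    Q′ :* (X′ :- X) :+ (Q′ :- t) :* X) refl Q X Q′ (X ^ q) θ ⟩
    Q′ * (X ^ q - X) + [ suc k ]q * X
      ≈⟨ +-congʳ (*-congˡ ([k]*E k x)) ⟨
    Q′ * ([ suc k ]q * E (suc k) x) + [ suc k ]q * X
      ≈⟨ solve 4 (λ Q D E X → Q :* (D :* E) :+ D :* X := D :* (Q :* E :+ X)) refl Q′ [ suc k ]q (E (suc k) x) X ⟩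
    [ suc k ]q * (Q′ * E (suc k) x + E k x) ∎)
    where
    Q  = θ ^ (q ℕ.^ k)
    Q′ = θ ^ (q ℕ.^ suc k)
    X  = E k x
    W  = E-pred k x

  E-fixed⇒0 : ∀ k {x} → E k x ^ q ≈ E k x → E (suc k) x ≈ 0#
  E-fixed⇒0 k e = trans (*-congʳ (x≈y⇒x-y≈0 e)) (zeroˡ _)

  -- Mutual induction: the value 1 is fixed by the q-th power, so the next polynomial vanishes at
  -- the same point, and then `E-θ*` carries the value 1 one power of θ further.
  E-diagonal : ∀ d → E d (θ ^ d) ≈ 1#
  E-next     : ∀ d → E (suc d) (θ ^ d) ≈ 0#

  E-diagonal zero    = refl
  E-diagonal (suc d) = begin
    E (suc d) (θ * θ ^ d)                            ≈⟨ E-θ* (suc d) (θ ^ d) ⟩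
    θ ^ (q ℕ.^ suc d) * E (suc d) (θ ^ d) + E d (θ ^ d) ≈⟨ +-cong (trans (*-congˡ (E-next d)) (zeroʳ _)) (E-diagonal d) ⟩
    0# + 1#                                          ≈⟨ +-identityˡ 1# ⟩
    1#                                               ∎

  E-next d = E-fixed⇒0 d (trans (^-congˡ q (E-diagonal d)) (trans (1^n≈1 q) (sym (E-diagonal d))))

  -- Multiplication of a power series by t
  shift : (ℕ → Carrier) → ℕ → Carrier
  shift f zero    = 0#
  shift f (suc j) = f j

  shift-cong : ∀ {f g} → (∀ j → f j ≈ g j) → ∀ j → shift f j ≈ shift g j
  shift-cong f≈g zero    = refl
  shift-cong f≈g (suc j) = f≈g j

  shift-*ʳ : ∀ f x j → shift (λ i → f i * x) j ≈ shift f j * x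
  shift-*ʳ f x zero    = sym (zeroˡ x)
  shift-*ʳ f x (suc j) = refl

  shift-+ : ∀ f g j → shift (λ i → f i + g i) j ≈ shift f j + shift g j
  shift-+ f g zero    = sym (+-identityˡ 0#)
  shift-+ f g (suc j) = refl

  shift-sub : ∀ f x g j → shift (λ i → f i - x * g i) j ≈ shift f j - x * shift g j
  shift-sub f x g zero    = solve 1 (λ x → 𝟘 := 𝟘 :- x :* 𝟘) refl x
  shift-sub f x g (suc j) = refl

  -- t^ d is the power series t^d, and b d is ∏_{i<d} (t − θ^{q^i}).
  t^ : ℕ → ℕ → Carrier
  t^ zero    zero    = 1#
  t^ zero    (suc j) = 0#
  t^ (suc d)         = shift (t^ d)

  b : ℕ → ℕ → Carrier
  b zero    j = t^ 0 j
  b (suc d) j = shift (b d) j - θ ^ (q ℕ.^ d) * b d j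

  -- Coefficient of t^j in the truncated Carlitz expansion ∑_{k<d} b_k(t) E_k(x), which is a(t) when
  -- x is a polynomial a in θ of degree less than d.
  R : ℕ → ℕ → Carrier → Carrier
  R zero    j x = 0#
  R (suc d) j x = R d j x + b d j * E d x

  R-linear : ∀ d j x c y → R d j (x + ι c * y) ≈ R d j x + ι c * R d j y
  R-linear zero    j x c y = solve 1 (λ c → 𝟘 := 𝟘 :+ c :* 𝟘) refl (ι c)
  R-linear (suc d) j x c y = begin
    R d j (x + ι c * y) + b d j * E d (x + ι c * y)
      ≈⟨ +-cong (R-linear d j x c y) (*-congˡ (E-linear d x c y)) ⟩
    R d j x + ι c * R d j y + b d j * (E d x + ι c * E d y)
      ≈⟨ solve 6 (λ R c S b E F → R :+ c :* S :+ b :* (E :+ c :* F) := R :+ b :* E :+ c :* (S :+ b :* F))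
           refl _ _ _ _ _ _ ⟩
    R d j x + b d j * E d x + ι c * (R d j y + b d j * E d y) ∎

  -- With t b_k = b_{k+1} + θ^{q^k} b_k and `E-θ*`, the terms b_k E_{k-1} telescope and only the
  -- boundary term at d survives.
  R-θ* : ∀ d j x → R d j (θ * x) ≈ shift (λ i → R d i x) j - b d j * E-pred d x
  R-θ* zero    j x = begin
    0#                                          ≈⟨ solve 1 (λ b → 𝟘 := 𝟘 :* 𝟘 :- b :* 𝟘) refl (b 0 j) ⟩
    0# * 0# - b 0 j * 0#                        ≈⟨ +-congʳ (trans (zeroʳ _) (sym (shift-0 j))) ⟩
    shift (λ _ → 0#) j - b 0 j * 0#             ∎
    where
    shift-0 : ∀ j → shift (λ _ → 0#) j ≈ 0#
    shift-0 zero    = refl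
    shift-0 (suc j) = refl
  R-θ* (suc d) j x = begin
    R d j (θ * x) + B * E d (θ * x)
      ≈⟨ +-cong (R-θ* d j x) (*-congˡ (E-θ* d x)) ⟩
    S - B * W + B * (Q * X + W)
      ≈⟨ solve 6 (λ S B W Q X T → S :- B :* W :+ B :* (Q :* X :+ W) :=
           S :+ T :* X :- (T :- Q :* B) :* X) refl S B W Q X (shift (b d) j) ⟩
    S + shift (b d) j * X - b (suc d) j * X
      ≈⟨ +-congʳ (trans (+-congˡ (sym (shift-*ʳ (b d) X j))) (sym (shift-+ (λ i → R d i x) (λ i → b d i * X) j))) ⟩
    shift (λ i → R d i x + b d i * X) j - b (suc d) j * X ∎
    where
    B = b d j
    S = shift (λ i → R d i x) j
    W = E-pred d x
    Q = θ ^ (q ℕ.^ d)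
    X = E d x

  -- Carlitz's expansion t^d = ∑_{k≤d} b_k(t) E_k(θ^d)
  R-θ^ : ∀ d j → R (suc d) j (θ ^ d) ≈ t^ d j
  R-θ^ zero    j = trans (+-identityˡ _) (*-identityʳ _)
  R-θ^ (suc d) j = begin
    R (suc (suc d)) j (θ * θ ^ d)
      ≈⟨ R-θ* (suc (suc d)) j (θ ^ d) ⟩
    shift (λ i → R (suc d) i (θ ^ d) + b (suc d) i * E (suc d) (θ ^ d)) j - b (suc (suc d)) j * E (suc d) (θ ^ d)
      ≈⟨ +-cong (shift-cong (λ i → trans (+-cong (R-θ^ d i) (*0 (b (suc d) i))) (+-identityʳ _)) j) (-‿cong (*0 _)) ⟩
    shift (t^ d) j - 0#
      ≈⟨ solve 1 (λ x → x :- 𝟘 := x) refl _ ⟩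
    shift (t^ d) j ∎
    where
    *0 : ∀ x → x * E (suc d) (θ ^ d) ≈ 0#
    *0 x = trans (*-congˡ (E-next d)) (zeroʳ x)

  -- The top term of Carlitz's expansion of t^d, whose factor E_d(θ^d) is 1.
  b-diagonal : ∀ d j → t^ d j - R d j (θ ^ d) ≈ b d j
  b-diagonal d j = begin
    t^ d j - r                         ≈⟨ +-congʳ (R-θ^ d j) ⟨
    r + b d j * E d (θ ^ d) - r        ≈⟨ +-congʳ (+-congˡ (*-congˡ (E-diagonal d))) ⟩
    r + b d j * 1# - r                 ≈⟨ solve 2 (λ r b → r :+ b :* 𝟙 :- r := b) refl r (b d j) ⟩
    b d j                              ∎
    where r = R d j (θ ^ d)

  -- Summation over polynomials, one coefficient at a time.

  coeff-∷ʳ : ∀ {d} (v : Vec 𝔽.Carrier d) c j →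
             ι (coeff (toList (v ∷ʳ c)) j) ≈ ι (coeff (toList v) j) + ι c * t^ d j
  coeff-∷ʳ []      c zero    = sym (trans (+-cong ι.0#-homo (*-identityʳ _)) (+-identityˡ _))
  coeff-∷ʳ []      c (suc j) = sym (trans (+-congˡ (zeroʳ _)) (+-identityʳ _))
  coeff-∷ʳ (x ∷ v) c zero    = sym (trans (+-congˡ (zeroʳ _)) (+-identityʳ _))
  coeff-∷ʳ (x ∷ v) c (suc j) = coeff-∷ʳ v c j

  ⟦⟧-∷ʳ : ∀ {d} (v : Vec 𝔽.Carrier d) c → ⟦ toList (v ∷ʳ c) ⟧ ≈ ⟦ toList v ⟧ + ι c * θ ^ d
  ⟦⟧-∷ʳ []      c = solve 2 (λ c t → c :+ t :* 𝟘 := 𝟘 :+ c :* 𝟙) refl (ι c) θ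
  ⟦⟧-∷ʳ {suc d} (x ∷ v) c = begin
    ι x + θ * ⟦ toList (v ∷ʳ c) ⟧                ≈⟨ +-congˡ (*-congˡ (⟦⟧-∷ʳ v c)) ⟩
    ι x + θ * (⟦ toList v ⟧ + ι c * θ ^ d)       ≈⟨ solve 5 (λ x t v c y → x :+ t :* (v :+ c :* y) :=
                                                      x :+ t :* v :+ c :* (t :* y)) refl _ _ _ _ _ ⟩
    ι x + θ * ⟦ toList v ⟧ + ι c * (θ * θ ^ d)   ∎

  ∑𝔽^-cong : ∀ d {f g : Vec 𝔽.Carrier d → Carrier} → (∀ v → f v ≈ g v) → ∑𝔽^ d f ≈ ∑𝔽^ d g
  ∑𝔽^-cong zero    f≈g = f≈g []
  ∑𝔽^-cong (suc d) f≈g = sum-cong-≋ {q} λ i → ∑𝔽^-cong d (λ v → f≈g (elem i ∷ v))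

  -- The sum is defined with the constant coefficient outermost, whereas the induction in `powerSum`
  -- needs the leading one there.
  ∑𝔽^-∷ʳ : ∀ d (f : Vec 𝔽.Carrier (suc d) → Carrier) →
           ∑𝔽^ (suc d) f ≈ sum (λ i → ∑𝔽^ d (λ v → f (v ∷ʳ elem i)))
  ∑𝔽^-∷ʳ zero    f = refl
  ∑𝔽^-∷ʳ (suc d) f = trans (sum-cong-≋ {q} λ i → ∑𝔽^-∷ʳ d (λ v → f (elem i ∷ v)))
                           (∑-comm {q} {q} (λ i i′ → ∑𝔽^ d (λ v → f (elem i ∷ (v ∷ʳ elem i′)))))

  ℓ : ℕ → Carrier
  ℓ zero    = 1#
  ℓ (suc d) = ℓ d * - [ suc d ]q

  ℓ≉0 : ∀ d → ¬ (ℓ d ≈ 0#)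
  ℓ≉0 zero    = 1≉0
  ℓ≉0 (suc d) = *-≉0 (ℓ≉0 d) (-‿≉0 [ d ]≉0)

  ⁻¹-neg : ∀ {x} → ¬ (x ≈ 0#) → - x ⁻¹ ≈ (- x) ⁻¹
  ⁻¹-neg {x} x≉0 = ⁻¹-unique (trans (solve 2 (λ x y → (:- x) :* (:- y) := x :* y) refl x (x ⁻¹)) (*-inverseʳ x x≉0))

  -- Write the numerator as (N - β y) + β (y + c). The second part cancels the denominator up to `m`
  -- and leaves a constant, whose q copies sum to 0; the first part is `sum-⁻¹`.
  sum-affine : ∀ N β m y → ¬ (m ≈ 0#) → ¬ (y ^ q - y ≈ 0#) → (∀ c → ¬ (y + ι c ≈ 0#)) →
               sum (λ i → (N + ι (elem i) * β) * (m * (y + ι (elem i))) ⁻¹) ≈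
               (N - β * y) * (- (m * (y ^ q - y))) ⁻¹
  sum-affine N β m y m≉0 y^q≉y y+c≉0 = begin
    sum (λ i → (N + ι (elem i) * β) * (m * (y + ι (elem i))) ⁻¹)
      ≈⟨ sum-cong-≋ {q} (λ i → term (elem i)) ⟩
    sum (λ i → A * (y + ι (elem i)) ⁻¹ + B)
      ≈⟨ ∑-distrib-+ {q} (λ i → A * (y + ι (elem i)) ⁻¹) (λ _ → B) ⟩
    sum (λ i → A * (y + ι (elem i)) ⁻¹) + sum {q} (λ _ → B)
      ≈⟨ +-cong (sym (*-distribˡ-sum {q} A (λ i → (y + ι (elem i)) ⁻¹))) (trans (sum-replicate q) (order×x≈0 B)) ⟩
    A * sum (λ i → (y + ι (elem i)) ⁻¹) + 0#
      ≈⟨ trans (+-identityʳ _) (*-congˡ (sum-⁻¹ y y^q≉y)) ⟩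
    (N - β * y) * m ⁻¹ * - (y ^ q - y) ⁻¹
      ≈⟨ solve 3 (λ N m z → N :* m :* (:- z) := N :* (:- (m :* z))) refl _ _ _ ⟩
    (N - β * y) * - (m ⁻¹ * (y ^ q - y) ⁻¹)
      ≈⟨ *-congˡ (trans (-‿cong (sym (⁻¹-distrib-* m≉0 y^q≉y))) (⁻¹-neg (*-≉0 m≉0 y^q≉y))) ⟩
    (N - β * y) * (- (m * (y ^ q - y))) ⁻¹ ∎
    where
    A = (N - β * y) * m ⁻¹
    B = β * m ⁻¹
    term : ∀ c → (N + ι c * β) * (m * (y + ι c)) ⁻¹ ≈ A * (y + ι c) ⁻¹ + B
    term c = begin
      (N + ι c * β) * (m * z) ⁻¹                 ≈⟨ *-cong (solve 4 (λ N c β y → N :+ c :* β := (N :- β :* y) :+ β :* (y :+ c)) refl N (ι c) β y)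
                                                      (⁻¹-distrib-* m≉0 (y+c≉0 c)) ⟩
      (N - β * y + β * z) * (m ⁻¹ * z ⁻¹)        ≈⟨ solve 5 (λ N β z m w → (N :+ β :* z) :* (m :* w) := N :* m :* w :+ β :* m :* (z :* w))
                                                      refl (N - β * y) β z (m ⁻¹) (z ⁻¹) ⟩
      A * z ⁻¹ + B * (z * z ⁻¹)                  ≈⟨ +-congˡ (trans (*-congˡ (*-inverseʳ z (y+c≉0 c))) (*-identityʳ B)) ⟩
      A * z ⁻¹ + B                               ∎
      where z = y + ι c

  -- The induction absorbs the leading coefficient `c` into the base point: `x` becomes
  -- `x + ι c * θ ^ d` and `ξ` becomes `ξ + ι c * t^ d j`, so both have to be arbitrary. The
  -- condition on `E d x` keeps the denominators nonzero, as the zeros of `E d` are the polynomials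
  -- in θ of degree less than d.
  powerSum : ∀ d x ξ j → ¬ (E d x ≈ 0#) →
             ∑𝔽^ d (λ v → (ξ + ι (coeff (toList v) j)) * (x + ⟦ toList v ⟧) ⁻¹) ≈
             (ξ - R d j x) * (ℓ d * E d x) ⁻¹
  powerSum zero    x ξ j _ =
    *-cong (trans (+-congˡ ι.0#-homo) (solve 1 (λ x → x :+ 𝟘 := x :- 𝟘) refl ξ))
           (⁻¹-cong (solve 1 (λ x → x :+ 𝟘 := 𝟙 :* x) refl x))
  powerSum (suc d) x ξ j Ex≉0 = begin
    ∑𝔽^ (suc d) (λ v → (ξ + ι (coeff (toList v) j)) * (x + ⟦ toList v ⟧) ⁻¹)
      ≈⟨ ∑𝔽^-∷ʳ d (λ v → (ξ + ι (coeff (toList v) j)) * (x + ⟦ toList v ⟧) ⁻¹) ⟩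
    sum (λ i → ∑𝔽^ d (λ v → (ξ + ι (coeff (toList (v ∷ʳ elem i)) j)) * (x + ⟦ toList (v ∷ʳ elem i) ⟧) ⁻¹))
      ≈⟨ sum-cong-≋ {q} (λ i → inner (elem i)) ⟩
    sum (λ i → (N + ι (elem i) * b d j) * (ℓ d * (y + ι (elem i))) ⁻¹)
      ≈⟨ sum-affine N (b d j) (ℓ d) y (ℓ≉0 d) y^q≉y y+c≉0 ⟩
    (N - b d j * y) * (- (ℓ d * (y ^ q - y))) ⁻¹
      ≈⟨ *-cong (solve 3 (λ x r z → x :- r :- z := x :- (r :+ z)) refl ξ (R d j x) (b d j * y))
           (⁻¹-cong (trans (-‿cong (*-congˡ (sym ([k]*E d x))))
             (solve 3 (λ l D E → :- (l :* (D :* E)) := l :* (:- D) :* E) refl (ℓ d) [ suc d ]q (E (suc d) x)))) ⟩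
    (ξ - R (suc d) j x) * (ℓ (suc d) * E (suc d) x) ⁻¹ ∎
    where
    y = E d x
    N = ξ - R d j x

    y^q≉y : ¬ (y ^ q - y ≈ 0#)
    y^q≉y e = Ex≉0 (E-fixed⇒0 d (x-y≈0⇒x≈y e))

    y+c≉0 : ∀ c → ¬ (y + ι c ≈ 0#)
    y+c≉0 c e = y^q≉y (begin
      y ^ q - y              ≈⟨ +-congʳ (^-congˡ q y≈-c) ⟩
      (- ι c) ^ q - y        ≈⟨ +-cong (trans (-‿^q (ι c)) (-‿cong (ι-^q c))) (-‿cong y≈-c) ⟩
      - ι c - - ι c          ≈⟨ -‿inverseʳ _ ⟩
      0#                     ∎)
      where
      y≈-c : y ≈ - ι c
      y≈-c = x-y≈0⇒x≈y (trans (solve 2 (λ y c → y :- (:- c) := y :+ c) refl y (ι c)) e)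

    E[x+cθ^d] : ∀ c → E d (x + ι c * θ ^ d) ≈ y + ι c
    E[x+cθ^d] c = trans (E-linear d x c (θ ^ d)) (+-congˡ (trans (*-congˡ (E-diagonal d)) (*-identityʳ _)))

    inner : ∀ c → ∑𝔽^ d (λ v → (ξ + ι (coeff (toList (v ∷ʳ c)) j)) * (x + ⟦ toList (v ∷ʳ c) ⟧) ⁻¹) ≈
                  (N + ι c * b d j) * (ℓ d * (y + ι c)) ⁻¹
    inner c = begin
      ∑𝔽^ d (λ v → (ξ + ι (coeff (toList (v ∷ʳ c)) j)) * (x + ⟦ toList (v ∷ʳ c) ⟧) ⁻¹)
        ≈⟨ ∑𝔽^-cong d (λ v → *-cong
             (trans (+-congˡ (coeff-∷ʳ v c j)) (solve 3 (λ x y z → x :+ (y :+ z) := x :+ z :+ y) refl ξ _ (ι c * t^ d j)))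
             (⁻¹-cong (trans (+-congˡ (⟦⟧-∷ʳ v c)) (solve 3 (λ x y z → x :+ (y :+ z) := x :+ z :+ y) refl x _ (ι c * θ ^ d))))) ⟩
      ∑𝔽^ d (λ v → (ξ + ι c * t^ d j + ι (coeff (toList v) j)) * (x + ι c * θ ^ d + ⟦ toList v ⟧) ⁻¹)
        ≈⟨ powerSum d (x + ι c * θ ^ d) (ξ + ι c * t^ d j) j (λ e → y+c≉0 c (trans (sym (E[x+cθ^d] c)) e)) ⟩
      (ξ + ι c * t^ d j - R d j (x + ι c * θ ^ d)) * (ℓ d * E d (x + ι c * θ ^ d)) ⁻¹
        ≈⟨ *-cong (begin
             ξ + ι c * t^ d j - R d j (x + ι c * θ ^ d)
               ≈⟨ +-congˡ (-‿cong (R-linear d j x c (θ ^ d))) ⟩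
             ξ + ι c * t^ d j - (R d j x + ι c * R d j (θ ^ d))
               ≈⟨ solve 5 (λ x c t r s → x :+ c :* t :- (r :+ c :* s) := x :- r :+ c :* (t :- s)) refl _ _ _ _ _ ⟩
             N + ι c * (t^ d j - R d j (θ ^ d))
               ≈⟨ +-congˡ (*-congˡ (b-diagonal d j)) ⟩
             N + ι c * b d j ∎)
           (⁻¹-cong (*-congˡ (E[x+cθ^d] c))) ⟩
      (N + ι c * b d j) * (ℓ d * (y + ι c)) ⁻¹ ∎

  powerSum-monic : ∀ d j → ∑𝔽^ d (λ v → ι (coeff (monic v) j) * (⟦ monic v ⟧ ^ 1) ⁻¹) ≈ b d j * ℓ d ⁻¹
  powerSum-monic d j = begin
    ∑𝔽^ d (λ v → ι (coeff (monic v) j) * (⟦ monic v ⟧ ^ 1) ⁻¹)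
      ≈⟨ ∑𝔽^-cong d (λ v → *-cong
           (trans (coeff-∷ʳ v 𝔽.1# j) (trans (+-comm _ _) (+-congʳ (1* _))))
           (⁻¹-cong (trans (*-identityʳ _) (trans (⟦⟧-∷ʳ v 𝔽.1#) (trans (+-comm _ _) (+-congʳ (1* _))))))) ⟩
    ∑𝔽^ d (λ v → (t^ d j + ι (coeff (toList v) j)) * (θ ^ d + ⟦ toList v ⟧) ⁻¹)
      ≈⟨ powerSum d (θ ^ d) (t^ d j) j (λ e → 1≉0 (trans (sym (E-diagonal d)) e)) ⟩
    (t^ d j - R d j (θ ^ d)) * (ℓ d * E d (θ ^ d)) ⁻¹
      ≈⟨ *-cong (b-diagonal d j) (⁻¹-cong (trans (*-congˡ (E-diagonal d)) (*-identityʳ _))) ⟩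
    b d j * ℓ d ⁻¹ ∎
    where
    1* : ∀ x → ι 𝔽.1# * x ≈ x
    1* x = trans (*-congʳ ι.1#-homo) (*-identityˡ x)

  -- ∏_{1≤i≤n} (t − θ^{q^i}) / (θ − θ^{q^i})
  G : ℕ → ℕ → Carrier
  G zero    j = t^ 0 j
  G (suc n) j = (shift (G n) j - θ ^ (q ℕ.^ suc n) * G n j) * (- [ suc n ]q) ⁻¹

  -- Of the factors of b_{n+1}, only t - θ, the one with i = 0, is absent from G_n.
  b≈[t-θ]G : ∀ n j → b (suc n) j * ℓ n ⁻¹ ≈ shift (G n) j - θ * G n j
  b≈[t-θ]G zero j = begin
    (shift (t^ 0) j - θ * 1# * t^ 0 j) * 1# ⁻¹     ≈⟨ *-congˡ 1⁻¹≈1 ⟩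
    (shift (t^ 0) j - θ * 1# * t^ 0 j) * 1#        ≈⟨ solve 3 (λ s t x → (s :- t :* 𝟙 :* x) :* 𝟙 := s :- t :* x) refl _ _ _ ⟩
    shift (t^ 0) j - θ * t^ 0 j                    ∎
  b≈[t-θ]G (suc n) j = begin
    (shift B j - Q * B j) * (ℓ n * m) ⁻¹
      ≈⟨ *-congˡ (⁻¹-distrib-* (ℓ≉0 n) (-‿≉0 [ n ]≉0)) ⟩
    (shift B j - Q * B j) * (ℓ n ⁻¹ * m ⁻¹)
      ≈⟨ solve 5 (λ s Q B l m → (s :- Q :* B) :* (l :* m) := (s :* l :- Q :* (B :* l)) :* m) refl _ _ _ _ _ ⟩
    (shift B j * ℓ n ⁻¹ - Q * (B j * ℓ n ⁻¹)) * m ⁻¹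
      ≈⟨ *-congʳ (+-cong (trans (sym (shift-*ʳ B (ℓ n ⁻¹) j))
            (trans (shift-cong (b≈[t-θ]G n) j) (shift-sub (shift (G n)) θ (G n) j)))
            (-‿cong (*-congˡ (b≈[t-θ]G n j)))) ⟩
    (shift (shift (G n)) j - θ * shift (G n) j - Q * (shift (G n) j - θ * G n j)) * m ⁻¹
      ≈⟨ solve 6 (λ s t x Q y m → (s :- t :* x :- Q :* (x :- t :* y)) :* m :=
            (s :- Q :* x) :* m :- t :* ((x :- Q :* y) :* m)) refl _ _ _ _ _ _ ⟩
    (shift (shift (G n)) j - Q * shift (G n) j) * m ⁻¹ - θ * G (suc n) j
      ≈⟨ +-congʳ (sym (trans (shift-*ʳ (λ i → shift (G n) i - Q * G n i) (m ⁻¹) j)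
            (*-congʳ (shift-sub (shift (G n)) Q (G n) j)))) ⟩
    shift (G (suc n)) j - θ * G (suc n) j ∎
    where
    B = b (suc n)
    Q = θ ^ (q ℕ.^ suc n)
    m = - [ suc n ]q

  -- With Q = θ^{q^{n+1}}, (t - Q)/(θ - Q) - 1 = (t - θ)/(θ - Q), so G_{n+1} - G_n is the next term.
  ∑b/ℓ≈G : ∀ n j → ∑< (suc n) (λ d → b d j * ℓ d ⁻¹) ≈ G n j
  ∑b/ℓ≈G zero j = trans (+-identityʳ _) (trans (*-congˡ 1⁻¹≈1) (*-identityʳ _))
  ∑b/ℓ≈G (suc n) j = begin
    ∑< (suc (suc n)) f                                 ≈⟨ sum-snoc (suc n) f ⟩
    ∑< (suc n) f + b (suc n) j * (ℓ n * m) ⁻¹          ≈⟨ +-cong (∑b/ℓ≈G n j) (*-congˡ (⁻¹-distrib-* (ℓ≉0 n) m≉0)) ⟩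
    G n j + b (suc n) j * (ℓ n ⁻¹ * m ⁻¹)              ≈⟨ +-congˡ (sym (*-assoc _ _ _)) ⟩
    G n j + b (suc n) j * ℓ n ⁻¹ * m ⁻¹                ≈⟨ +-cong (sym (x≈y*z⇒x*z⁻¹≈y m≉0 refl)) (*-congʳ (b≈[t-θ]G n j)) ⟩
    G n j * m * m ⁻¹ + (shift (G n) j - θ * G n j) * m ⁻¹ ≈⟨ solve 5 (λ g Q t s w → g :* (:- (Q :- t)) :* w :+ (s :- t :* g) :* w :=
                                                              (s :- Q :* g) :* w) refl (G n j) (θ ^ (q ℕ.^ suc n)) θ _ _ ⟩
    G (suc n) j                                        ∎
    where
    f = λ d → b d j * ℓ d ⁻¹
    m = - [ suc n ]q
    m≉0 = -‿≉0 [ n ]≉0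

-- The Carlitz exponential, its period, and the passage to the limit.

module CarlitzPeriod {a ℓ₁ c ℓ₂ q} {𝔽q : FiniteField a ℓ₁ q} (ℂ∞ : Cinf 𝔽q c ℓ₂) (1<q : 1 ℕ.< q)
  (+-^q : FieldProperties.AdditivePower (Cinf.fld ℂ∞) q)
  (π̃ : Cinf.Carrier ℂ∞) (isPeriod : Carlitz.IsFundamentalPeriod ℂ∞ π̃)
  where
  private module 𝔽 = FiniteField 𝔽q
  open Cinf ℂ∞ hiding (zero)
  open Carlitz ℂ∞
  open Carlitz.IsFundamentalPeriod isPeriod
  open Polynomial 𝔽.fld using (coeff; monic)
  open FieldProperties fld
  open Valuation ℂ∞
  open PowerSums ℂ∞ 1<q +-^q
  open import Data.Fin.Properties using (toℕ<n)
  open import Relation.Binary.Reasoning.Setoid setoid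
  open import Data.List.Base using ([]; _∷_)
  import Algebra.Properties.CommutativeMonoid.Sum *-commutativeMonoid as ∏
  module Π = SumProperties *-commutativeMonoid

  q^_ : ℕ → ℕ
  q^ n = q ℕ.^ n

  -- The shape is that of the recursion for `G`; with `Q` and `k` equal to 1 it also handles
  -- differences of sums.
  sum-linear : ∀ {n} Q k (f g : Fin n → Carrier) →
               sum (λ i → (f i - Q * g i) * k) ≈ (sum f - Q * sum g) * k
  sum-linear {zero}  Q k f g = solve 2 (λ Q k → 𝟘 := (𝟘 :- Q :* 𝟘) :* k) refl Q k
  sum-linear {suc n} Q k f g = trans (+-congˡ (sum-linear Q k (f ∘ suc) (g ∘ suc)))
    (solve 6 (λ f Q g k F G → (f :- Q :* g) :* k :+ (F :- Q :* G) :* k := (f :+ F :- Q :* (g :+ G)) :* k)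
       refl _ _ _ _ _ _)

  sum-≼ : ∀ {n} {f : Fin n → Carrier} {x} → (∀ i → f i ≼ x) → sum f ≼ x
  sum-≼ {zero}  f≼x = 0≼ refl
  sum-≼ {suc n} f≼x = +-≼ (f≼x zero) (sum-≼ (f≼x ∘ suc))

  product-^ : ∀ {n} (f : Fin n → Carrier) m → product (λ i → f i ^ m) ≈ product f ^ m
  product-^ {zero}  f m = sym (1^n≈1 m)
  product-^ {suc n} f m = trans (*-congˡ (product-^ (f ∘ suc) m)) (sym (^-distrib-* _ _ m))

  -- The infinite product in the formula for π̃.

  w : ℕ → Carrier
  w n = (1# - ε n) ⁻¹

  w≼1 : ∀ n → w n ≼ 1#
  w≼1 n = [1-ε]⁻¹≼1 (ε≼u n)

  w-1≼u^ : ∀ n → w n - 1# ≼ u ^ suc n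
  w-1≼u^ n = ≼-trans ([1-ε]⁻¹-1≼ε (ε≼u n)) (ε≼u^ n)

  P∞ : Carrier
  P∞ = ∏∞ w

  ∏w-suc : ∀ n → ∏< (suc n) w ≈ ∏< n w * w n
  ∏w-suc n = Π.sum-snoc n w

  ∏w≼1 : ∀ n → ∏< n w ≼ 1#
  ∏w≼1 zero    = ≼-refl
  ∏w≼1 (suc n) = ≼-respˡ (∏w-suc n) (*-≼1 (∏w≼1 n) (w≼1 n))

  ∏w-rate : ∀ n → ∏< n w - P∞ ≼ u * u ^ n
  ∏w-rate = lim-rate (λ n → ∏< n w) u u≉0 λ n →
    ≼-respˡ (trans (+-congʳ (∏w-suc n)) (solve 2 (λ P w → P :* w :- P := (w :- 𝟙) :* P) refl _ _))
      (*-≼1 (w-1≼u^ n) (∏w≼1 n))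

  1-P∞≼u : 1# - P∞ ≼ u
  -- The rate at 0, where the finite product is empty.
  1-P∞≼u = ≼-respʳ (*-identityʳ u) (∏w-rate 0)

  P∞≈1-[1-P∞] : P∞ ≈ 1# - (1# - P∞)
  P∞≈1-[1-P∞] = solve 1 (λ P → P := 𝟙 :- (𝟙 :- P)) refl P∞

  P∞≉0 : ¬ (P∞ ≈ 0#)
  P∞≉0 e = 1-ε≉0 1-P∞≼u (trans (sym P∞≈1-[1-P∞]) e)

  P∞≼1 : P∞ ≼ 1#
  P∞≼1 = ≼-respˡ P∞≈1-[1-P∞] (-≼ ≼-refl (≼-trans 1-P∞≼u u≼1))

  -- Convergence of G_n to L(χ_t,1).

  -[n]⁻¹ : ∀ n → (- [ suc n ]q) ⁻¹ ≈ - (u ^ (q^ suc n) * w n)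
  -[n]⁻¹ n = sym (⁻¹-unique (begin
    - [ suc n ]q * - (U * W)         ≈⟨ solve 3 (λ D U W → (:- D) :* (:- (U :* W)) := D :* U :* W) refl [ suc n ]q U W ⟩
    [ suc n ]q * U * W               ≈⟨ *-congʳ (*-congʳ ([n]≈θ^*[1-ε] n)) ⟩
    Q * (1# - ε n) * U * W           ≈⟨ solve 4 (λ Q e U W → Q :* e :* U :* W := (Q :* U) :* (e :* W)) refl Q _ U W ⟩
    (Q * U) * ((1# - ε n) * W)       ≈⟨ *-cong (θ^n*u^n≈1 (q^ suc n)) (*-inverseʳ _ (1-ε≉0 (ε≼u n))) ⟩
    1# * 1#                          ≈⟨ *-identityˡ 1# ⟩
    1#                               ∎))
    where
    Q = θ ^ (q^ suc n)
    U = u ^ (q^ suc n)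
    W = w n

  -- With θ^{q^{n+1}} cancelled, one step multiplies by `w n`, which is close to 1, and subtracts a
  -- multiple of a tiny power of `u`.
  G-suc : ∀ n j → G (suc n) j ≈ w n * G n j - u ^ (q^ suc n) * w n * shift (G n) j
  G-suc n j = begin
    (S - Q * g) * (- [ suc n ]q) ⁻¹      ≈⟨ *-congˡ (-[n]⁻¹ n) ⟩
    (S - Q * g) * - (U * W)              ≈⟨ solve 5 (λ S Q g U W → (S :- Q :* g) :* (:- (U :* W)) :=
                                              Q :* U :* (W :* g) :- U :* W :* S) refl S Q g U W ⟩
    Q * U * (W * g) - U * W * S          ≈⟨ +-congʳ (trans (*-congʳ (θ^n*u^n≈1 (q^ suc n))) (*-identityˡ _)) ⟩
    W * g - U * W * S                    ∎
    where
    Q = θ ^ (q^ suc n)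
    U = u ^ (q^ suc n)
    W = w n
    S = shift (G n) j
    g = G n j

  shift-≼ : ∀ {f x} → (∀ j → f j ≼ x) → ∀ j → shift f j ≼ x
  shift-≼ f≼x zero    = 0≼ refl
  shift-≼ f≼x (suc j) = f≼x j

  u^q^≼u^ : ∀ n → u ^ (q^ n) ≼ u ^ n
  u^q^≼u^ n = u^-antimono (ℕ.<⇒≤ (n<q^n n))

  uwG≼u^ : ∀ n j → (∀ i → G n i ≼ 1#) → u ^ (q^ suc n) * w n * shift (G n) j ≼ u ^ suc n
  uwG≼u^ n j G≼1 = *-≼1 (*-≼1 (u^q^≼u^ (suc n)) (w≼1 n)) (shift-≼ G≼1 j)

  G≼1 : ∀ n j → G n j ≼ 1#
  G≼1 zero    zero    = ≼-refl
  G≼1 zero    (suc j) = 0≼ refl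
  G≼1 (suc n) j = ≼-respˡ (G-suc n j)
    (-≼ (*-≼1 (w≼1 n) (G≼1 n j)) (≼-trans (uwG≼u^ n j (G≼1 n)) (u^n≼1 (suc n))))

  G-step : ∀ n j → G (suc n) j - G n j ≼ u ^ suc n
  G-step n j = ≼-respˡ (trans (+-congʳ (G-suc n j))
      (solve 3 (λ w g x → w :* g :- x :- g := (w :- 𝟙) :* g :- x) refl _ _ _))
    (-≼ (*-≼1 (w-1≼u^ n) (G≼1 n j)) (uwG≼u^ n j (G≼1 n)))

  partialL : ℕ → ℕ → Carrier
  partialL j n = ∑< n (λ d → ∑𝔽^ d (λ v → ι (coeff (monic v) j) * (⟦ monic v ⟧ ^ 1) ⁻¹))

  partialL≈G : ∀ n j → partialL j (suc n) ≈ G n j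
  partialL≈G n j = trans (sum-cong-≋ {suc n} λ i → powerSum-monic (toℕ i) j) (∑b/ℓ≈G n j)

  G-rate : ∀ n j → G n j - L 1 j ≼ u ^ suc n
  G-rate n j = ≼-respʳ (*-identityˡ _) (≼-respˡ (+-congʳ (sym (partialL≈G n j)))
    (lim-rate (partialL j) 1# 1≉0 step (suc n)))
    where
    step : ∀ n → partialL j (suc n) - partialL j n ≼ 1# * u ^ n
    step zero    = ≼-respʳ (sym (*-identityˡ _))
      (≼-respˡ (trans (+-congʳ (partialL≈G 0 j)) (solve 1 (λ x → x :- 𝟘 := x) refl _)) (G≼1 0 j))
    step (suc n) = ≼-respʳ (sym (*-identityˡ _))
      (≼-respˡ (+-cong (partialL≈G (suc n) j) (-‿cong (partialL≈G n j))) (G-step n j))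

  -- The Carlitz exponential on the disc of radius |ρ|.

  root^q : root ^ q ≈ - (θ * root)
  root^q = begin
    root ^ q                       ≡⟨ ≡.cong (root ^_) (ℕ.suc-pred q) ⟨
    root * root ^ (ℕ.pred q)       ≈⟨ *-congˡ root-correct ⟩
    root * - θ                     ≈⟨ solve 2 (λ r t → r :* (:- t) := :- (t :* r)) refl root θ ⟩
    - (θ * root)                   ∎

  root≉0 : ¬ (root ≈ 0#)
  root≉0 e = -‿≉0 θ≉0 (begin
    - θ                ≈⟨ root-correct ⟨
    root ^ (q ∸ 1)     ≈⟨ ^-congˡ (q ∸ 1) e ⟩
    0# ^ (q ∸ 1)       ≈⟨ 0^n≈0 (q ∸ 1) {{ℕ.>-nonZero (ℕ.m<n⇒0<n∸m 1<q)}} ⟩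
    0#                 ∎)

  -- |ρ|^q = |θ ρ|, while the q-th power can only shrink `u ^ n`.
  ^q-≼ : ∀ {x} n → x ≼ root * u ^ n → x ^ q ≼ θ * root * u ^ n
  ^q-≼ {x} n x≼ = ≼-trans (^-mono-≼ q x≼) (≼-respˡ (^-distrib-* root (u ^ n) q)
    (*-mono-≼ (≼-respˡ root^q (-‿≼ ≼-refl))
      (≼-respˡ (^-assocʳ u n q) (u^-antimono (ℕ.m≤m*n n q)))))

  d-suc : ∀ n → d (suc n) ≈ [ suc n ]q * d n ^ q
  d-suc n = *-cong (*-identityʳ _) (begin
    product {n} (λ i → [ n ∸ toℕ i ]q ^ (q ℕ.* q^ (toℕ i)))     ≈⟨ ∏.sum-cong-≋ {n} (λ i → ^q^-suc _ (toℕ i)) ⟩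
    product {n} (λ i → ([ n ∸ toℕ i ]q ^ (q^ (toℕ i))) ^ q)     ≈⟨ product-^ {n} (λ i → [ n ∸ toℕ i ]q ^ (q^ (toℕ i))) q ⟩
    d n ^ q                                                     ∎)

  d≉0 : ∀ n → ¬ (d n ≈ 0#)
  d≉0 zero    = 1≉0
  d≉0 (suc n) e = *-≉0 [ n ]≉0 (^-≉0 q (d≉0 n)) (trans (sym (d-suc n)) e)

  T : Carrier → ℕ → Carrier
  T η n = η ^ (q^ n) * d n ⁻¹

  T-zero : ∀ η → T η 0 ≈ η
  T-zero η = trans (*-cong (*-identityʳ η) 1⁻¹≈1) (*-identityʳ η)

  T-suc : ∀ η n → T η (suc n) ≈ T η n ^ q * [ suc n ]q ⁻¹
  T-suc η n = begin
    η ^ (q^ suc n) * d (suc n) ⁻¹                      ≈⟨ *-cong (^q^-suc η n) (⁻¹-cong (d-suc n)) ⟩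
    (η ^ (q^ n)) ^ q * ([ suc n ]q * d n ^ q) ⁻¹       ≈⟨ *-congˡ (⁻¹-distrib-* [ n ]≉0 (^-≉0 q (d≉0 n))) ⟩
    (η ^ (q^ n)) ^ q * ([ suc n ]q ⁻¹ * (d n ^ q) ⁻¹)  ≈⟨ solve 3 (λ x y z → x :* (y :* z) := x :* z :* y) refl _ _ _ ⟩
    (η ^ (q^ n)) ^ q * (d n ^ q) ⁻¹ * [ suc n ]q ⁻¹    ≈⟨ *-congʳ (*-congˡ (⁻¹-^ (d≉0 n) q)) ⟩
    (η ^ (q^ n)) ^ q * (d n ⁻¹) ^ q * [ suc n ]q ⁻¹    ≈⟨ *-congʳ (^-distrib-* _ _ q) ⟨
    T η n ^ q * [ suc n ]q ⁻¹                          ∎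

  [n]*T-suc : ∀ η n → [ suc n ]q * T η (suc n) ≈ T η n ^ q
  [n]*T-suc η n = begin
    [ suc n ]q * T η (suc n)                    ≈⟨ *-congˡ (T-suc η n) ⟩
    [ suc n ]q * (T η n ^ q * [ suc n ]q ⁻¹)    ≈⟨ solve 3 (λ x y z → x :* (y :* z) := y :* (x :* z)) refl _ _ _ ⟩
    T η n ^ q * ([ suc n ]q * [ suc n ]q ⁻¹)    ≈⟨ trans (*-congˡ (*-inverseʳ _ [ n ]≉0)) (*-identityʳ _) ⟩
    T η n ^ q                                   ∎

  -- Passing from one term to the next costs a factor θ by `^q-≼` and gains `u * u` from 1/[n+1], as
  -- q^{n+1} is at least 2. The net effect is one factor `u`.
  T≼ : ∀ {η} → η ≼ root → ∀ n → T η n ≼ root * u ^ n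
  T≼ {η} η≼root zero    = ≼-respˡ (T-zero η) (≼-respʳ (sym (*-identityʳ root)) η≼root)
  T≼ {η} η≼root (suc n) = ≼-respˡ (T-suc η n) (≼-respʳ cancel
    (*-mono-≼ (^q-≼ n (T≼ η≼root n)) [n]⁻¹≼))
    where
    [n]⁻¹≼ : [ suc n ]q ⁻¹ ≼ u * u
    [n]⁻¹≼ = ≼-respˡ (trans (solve 1 (λ x → x := :- (:- x)) refl _)
        (-‿cong (trans (⁻¹-neg [ n ]≉0) (-[n]⁻¹ n))))
      (-‿≼ (-‿≼ (*-≼1 (≼-respʳ (*-congˡ (*-identityʳ u))
        (u^-antimono (ℕ.≤-trans (s≤s (s≤s z≤n)) (n<q^n (suc n))))) (w≼1 n))))

    cancel : θ * root * u ^ n * (u * u) ≈ root * u ^ suc n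
    cancel = begin
      θ * root * u ^ n * (u * u)     ≈⟨ solve 4 (λ t r x u → t :* r :* x :* (u :* u) := t :* u :* (r :* (u :* x))) refl θ root _ u ⟩
      θ * u * (root * u ^ suc n)     ≈⟨ trans (*-congʳ θ*u≈1) (*-identityˡ _) ⟩
      root * u ^ suc n               ∎

  partialE : Carrier → ℕ → Carrier
  partialE η n = ∑< n (T η)

  partialE-rate : ∀ {η} → η ≼ root → ∀ n → partialE η n - eCar η ≼ root * u ^ n
  partialE-rate {η} η≼root = lim-rate (partialE η) root root≉0 λ n →
    ≼-respˡ (trans (+-congʳ (sum-snoc n (T η))) (solve 2 (λ x y → x :+ y :- x := y) refl _ _)) (T≼ η≼root n)

  -- The partial sum with a single term is `η`, so this is the rate at 1.
  eCar-η≼ : ∀ {η} → η ≼ root → eCar η - η ≼ root * u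
  eCar-η≼ {η} η≼root = ≼-respˡ (trans
      (solve 2 (λ x y → x :- y := :- (y :- x)) refl (eCar η) η)
      (-‿cong (+-congʳ (sym (trans (+-identityʳ _) (T-zero η))))))
    (-‿≼ (≼-respʳ (*-congˡ (*-identityʳ u)) (partialE-rate η≼root 1)))

  -- Split θ^{q^{n+1}} as θ + [n+1]; the factor [n+1] cancels against the one in d_{n+1}.
  T-θ* : ∀ {η ζ} → ζ ≈ θ * η → ∀ n → T ζ (suc n) ≈ θ * T η (suc n) + T η n ^ q
  T-θ* {η} {ζ} ζ≈θη n = begin
    ζ ^ Q * D ⁻¹                                   ≈⟨ *-congʳ (trans (^-congˡ Q ζ≈θη) (^-distrib-* θ η Q)) ⟩
    θ ^ Q * η ^ Q * D ⁻¹                           ≈⟨ solve 4 (λ t Q x y → Q :* x :* y := t :* (x :* y) :+ (Q :- t) :* (x :* y)) refl θ _ _ _ ⟩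
    θ * T η (suc n) + [ suc n ]q * T η (suc n)     ≈⟨ +-congˡ ([n]*T-suc η n) ⟩
    θ * T η (suc n) + T η n ^ q                    ∎
    where
    Q = q^ suc n
    D = d (suc n)

  partialE-θ* : ∀ {η ζ} → ζ ≈ θ * η → ∀ n →
                partialE ζ (suc n) ≈ θ * partialE η (suc n) + partialE η n ^ q
  partialE-θ* {η} {ζ} ζ≈θη zero = begin
    T ζ 0 + 0#                       ≈⟨ +-congʳ (trans (T-zero ζ) (trans ζ≈θη (*-congˡ (sym (T-zero η))))) ⟩
    θ * T η 0 + 0#                   ≈⟨ solve 2 (λ t x → t :* x :+ 𝟘 := t :* (x :+ 𝟘) :+ 𝟘) refl θ (T η 0) ⟩
    θ * (T η 0 + 0#) + 0#            ≈⟨ +-congˡ 0^q≈0 ⟨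
    θ * (T η 0 + 0#) + 0# ^ q        ∎
  partialE-θ* {η} {ζ} ζ≈θη (suc n) = begin
    partialE ζ (suc (suc n))
      ≈⟨ sum-snoc (suc n) (T ζ) ⟩
    partialE ζ (suc n) + T ζ (suc n)
      ≈⟨ +-cong (partialE-θ* ζ≈θη n) (T-θ* ζ≈θη n) ⟩
    θ * partialE η (suc n) + partialE η n ^ q + (θ * T η (suc n) + T η n ^ q)
      ≈⟨ solve 5 (λ t x y z w → t :* x :+ y :+ (t :* z :+ w) := t :* (x :+ z) :+ (y :+ w)) refl _ _ _ _ _ ⟩
    θ * (partialE η (suc n) + T η (suc n)) + (partialE η n ^ q + T η n ^ q)
      ≈⟨ +-cong (*-congˡ (sum-snoc (suc n) (T η))) (trans (^-congˡ q (sum-snoc n (T η))) (+-^q _ _)) ⟨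
    θ * partialE η (suc (suc n)) + partialE η (suc n) ^ q ∎

  -- Only `η` is assumed to lie in the disc where `partialE-rate` applies. For η = π̃/θ the point ζ
  -- = π̃ lies outside it, so convergence at ζ is deduced from that at η.
  eCar-θ* : ∀ {η ζ} → η ≼ root → ζ ≈ θ * η → eCar ζ ≈ θ * eCar η + eCar η ^ q
  eCar-θ* {η} {ζ} η≼root ζ≈θη = rate⇒lim (partialE ζ) (θ * root) λ n → ≼-respˡ (begin
    partialE ζ (suc n) - (θ * e + e ^ q)
      ≈⟨ +-congʳ (partialE-θ* ζ≈θη n) ⟩
    θ * partialE η (suc n) + partialE η n ^ q - (θ * e + e ^ q)
      ≈⟨ solve 5 (λ t x y z w → t :* x :+ y :- (t :* z :+ w) := t :* (x :- z) :+ (y :- w)) refl _ _ _ _ _ ⟩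
    θ * (partialE η (suc n) - e) + (partialE η n ^ q - e ^ q)
      ≈⟨ +-congˡ (sub-^q _ _) ⟨
    θ * (partialE η (suc n) - e) + (partialE η n - e) ^ q ∎)
    (+-≼ (≼-respʳ (sym (*-assoc _ _ _)) (*-mono-≼ ≼-refl
            (≼-trans (partialE-rate η≼root (suc n)) (*-mono-≼ ≼-refl (u^-antimono (ℕ.n≤1+n n))))))
         (^q-≼ n (partialE-rate η≼root n)))
    where e = eCar η

  -- The coefficients of s_Car.

  η : ℕ → Carrier
  η j = π̃ * (θ ^ suc j) ⁻¹

  θ*η-zero : π̃ ≈ θ * η 0
  θ*η-zero = sym (begin
    θ * (π̃ * (θ * 1#) ⁻¹)       ≈⟨ *-congˡ (*-congˡ (⁻¹-cong (*-identityʳ θ))) ⟩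
    θ * (π̃ * u)                 ≈⟨ solve 3 (λ t p u → t :* (p :* u) := t :* u :* p) refl θ π̃ u ⟩
    θ * u * π̃                   ≈⟨ trans (*-congʳ θ*u≈1) (*-identityˡ π̃) ⟩
    π̃                           ∎)

  θ*η-suc : ∀ j → η j ≈ θ * η (suc j)
  θ*η-suc j = sym (begin
    θ * (π̃ * (θ * θ ^ suc j) ⁻¹)           ≈⟨ *-congˡ (*-congˡ (⁻¹-distrib-* θ≉0 (^-≉0 (suc j) θ≉0))) ⟩
    θ * (π̃ * (u * (θ ^ suc j) ⁻¹))         ≈⟨ solve 4 (λ t p u x → t :* (p :* (u :* x)) := t :* u :* (p :* x)) refl θ π̃ u _ ⟩
    θ * u * η j                            ≈⟨ trans (*-congʳ θ*u≈1) (*-identityˡ _) ⟩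
    η j                                    ∎)

  η≈ : ∀ j → η j ≈ root * u ^ j * P∞
  η≈ j = begin
    π̃ * (θ ^ suc j) ⁻¹                       ≈⟨ *-cong formula (⁻¹-^ θ≉0 (suc j)) ⟩
    θ * root * P∞ * (u * u ^ j)              ≈⟨ solve 5 (λ t r P u x → t :* r :* P :* (u :* x) := t :* u :* (r :* x :* P)) refl θ root P∞ u _ ⟩
    θ * u * (root * u ^ j * P∞)              ≈⟨ trans (*-congʳ θ*u≈1) (*-identityˡ _) ⟩
    root * u ^ j * P∞                        ∎

  η≼root*u^ : ∀ j → η j ≼ root * u ^ j
  η≼root*u^ j = ≼-respˡ (η≈ j) (*-≼1 ≼-refl P∞≼1)

  η≼root : ∀ j → η j ≼ root
  η≼root j = ≼-trans (η≼root*u^ j) (*-≼1 ≼-refl (u^n≼1 j))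

  lam : ℕ → Carrier
  lam = sCar π̃

  eCar-π̃≈0 : eCar π̃ ≈ 0#
  eCar-π̃≈0 = Equivalence.from (kernel π̃) (𝔽.1# ∷ [] , (begin
    π̃                           ≈⟨ solve 2 (λ p t → p := (𝟙 :+ t :* 𝟘) :* p) refl π̃ θ ⟩
    (1# + θ * 0#) * π̃           ≈⟨ *-congʳ (+-congʳ ι.1#-homo) ⟨
    (ι 𝔽.1# + θ * 0#) * π̃       ∎))

  lam-recurrence : ∀ m → shift lam m - θ * lam m ≈ lam m ^ q
  lam-recurrence m = begin
    shift lam m - θ * lam m                       ≈⟨ +-congʳ (go m) ⟩
    θ * lam m + lam m ^ q - θ * lam m             ≈⟨ solve 2 (λ x y → x :+ y :- x := y) refl _ _ ⟩
    lam m ^ q                                     ∎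
    where
    go : ∀ m → shift lam m ≈ θ * lam m + lam m ^ q
    -- The zero that `shift` puts at index 0 is e(π̃), the value a coefficient of index -1 would
    -- have.
    go zero    = trans (sym eCar-π̃≈0) (eCar-θ* (η≼root 0) θ*η-zero)
    go (suc m) = eCar-θ* (η≼root (suc m)) (θ*η-suc m)

  -- δ = λ₀ − root satisfies δ^q = −θ δ and is too small for a nonzero solution.
  lam-zero : lam 0 ≈ root
  lam-zero with (lam 0 - root) ≈0?
  ... | yes δ≈0 = x-y≈0⇒x≈y δ≈0
  ... | no δ≉0  = ⊥-elim (small-absurd (-‿≉0 θ≉0) -θ≼)
    where
    δ = lam 0 - root

    δ≼ : δ ≼ root * u
    -- λ_0 is close to η_0 = ρ P∞, and P∞ is close to 1.
    δ≼ = ≼-respˡ (solve 3 (λ l r e → l :- r := (l :- e) :+ (e :- r)) refl (lam 0) root (η 0))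
      (+-≼ (eCar-η≼ (η≼root 0))
        (≼-respˡ (trans (+-congʳ (η≈ 0)) (solve 2 (λ r P → r :* 𝟙 :* P :- r := r :* (:- (𝟙 :- P))) refl root P∞))
          (*-mono-≼ ≼-refl (-‿≼ 1-P∞≼u))))

    lam-zero^q : lam 0 ^ q ≈ - (θ * lam 0)
    lam-zero^q = trans (sym (lam-recurrence 0)) (+-identityˡ _)

    δ^q : δ ^ q ≈ - θ * δ
    δ^q = begin
      δ ^ q                              ≈⟨ sub-^q (lam 0) root ⟩
      lam 0 ^ q - root ^ q               ≈⟨ +-cong lam-zero^q (-‿cong root^q) ⟩
      - (θ * lam 0) - - (θ * root)       ≈⟨ solve 3 (λ t x y → :- (t :* x) :- (:- (t :* y)) := (:- t) :* (x :- y)) refl θ _ root ⟩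
      - θ * δ                            ∎

    δ^[q-1] : - θ ≈ δ ^ (q ∸ 1)
    δ^[q-1] = sym (*-cancelˡ δ≉0 (begin
      δ ^ suc (ℕ.pred q)     ≡⟨ ≡.cong (δ ^_) (ℕ.suc-pred q) ⟩
      δ ^ q                  ≈⟨ δ^q ⟩
      - θ * δ                ≈⟨ *-comm _ _ ⟩
      δ * - θ                ∎))

    -- Dividing δ^q = -θ δ by δ gives -θ = δ^{q-1}, but |δ| ≤ |ρ u| bounds this by |ρ^{q-1} u^{q-1}|
    -- = |θ u^{q-1}|.
    -θ≼ : - θ ≼ - θ * u
    -θ≼ = ≼-respˡ δ^[q-1] (≼-trans (^-mono-≼ (q ∸ 1) δ≼)
      (≼-respˡ (trans (^-distrib-* root u (q ∸ 1)) (*-congʳ root-correct))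
        (*-mono-≼ ≼-refl (≼-respʳ (*-identityʳ u) (u^-antimono (ℕ.m<n⇒0<n∸m 1<q))))))

  lam-suc≼ : ∀ j → lam (suc j) ≼ root * u
  lam-suc≼ j = ≼-respˡ (solve 2 (λ l e → l := (l :- e) :+ e) refl (lam (suc j)) (η (suc j)))
    (+-≼ (eCar-η≼ (η≼root (suc j)))
         (≼-trans (η≼root*u^ (suc j)) (*-mono-≼ ≼-refl (≼-respʳ (*-identityʳ u) (u^-antimono {1} {suc j} (s≤s z≤n))))))

  lam≼root : ∀ j → lam j ≼ root
  lam≼root zero    = ≼-reflexive lam-zero
  lam≼root (suc j) = ≼-trans (lam-suc≼ j) (*-≼1 ≼-refl u≼1)

  -- Multiplying (t - θ) s_Car by G_n and by L.

  H : ℕ → Carrier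
  H m = lam m ^ q

  ⊛-cong : ∀ {f f′ g} → f ≋ f′ → f ⊛ g ≋ f′ ⊛ g
  ⊛-cong {g = g} f≋f′ m = sum-cong-≋ {suc m} λ i → *-congʳ {g (m ∸ toℕ i)} (f≋f′ (toℕ i))

  const-⊛ : ∀ x f → const x ⊛ f ≋ λ m → x * f m
  const-⊛ x f m = trans (+-congˡ (sum-zero {m} λ i → zeroˡ _)) (+-identityʳ _)

  [t-θ]⊛ : ∀ f m → ((t ⊖ const θ) ⊛ f) m ≈ shift f m - θ * f m
  [t-θ]⊛ f zero = solve 2 (λ t x → (𝟘 :- t) :* x :+ 𝟘 := 𝟘 :- t :* x) refl θ (f 0)
  [t-θ]⊛ f (suc m) = begin
    (0# - θ) * f (suc m) + ((1# - 0#) * f m + rest)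
      ≈⟨ +-congˡ (+-congˡ (sum-zero {m} λ i → solve 1 (λ x → (𝟘 :- 𝟘) :* x := 𝟘) refl _)) ⟩
    (0# - θ) * f (suc m) + ((1# - 0#) * f m + 0#)
      ≈⟨ solve 3 (λ t x y → (𝟘 :- t) :* x :+ ((𝟙 :- 𝟘) :* y :+ 𝟘) := y :- t :* x) refl θ _ _ ⟩
    f m - θ * f (suc m) ∎
    where rest = sum {m} (λ i → (0# - 0#) * f (m ∸ suc (toℕ i)))

  [t-θ]s≋H : (t ⊖ const θ) ⊛ lam ≋ H
  [t-θ]s≋H m = trans ([t-θ]⊛ lam m) (lam-recurrence m)

  ⊛-1 : ∀ f → f ⊛ t^ 0 ≋ f
  ⊛-1 f m = begin
    (f ⊛ t^ 0) m                                          ≈⟨ sum-snoc m (λ i → f i * t^ 0 (m ∸ i)) ⟩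
    ∑< m (λ i → f i * t^ 0 (m ∸ i)) + f m * t^ 0 (m ∸ m)  ≈⟨ +-cong
        (sum-zero {m} λ i → trans (*-congˡ (t^0≈0 (ℕ.m<n⇒0<n∸m (toℕ<n i)))) (zeroʳ _))
        (*-congˡ (reflexive (≡.cong (t^ 0) (ℕ.n∸n≡0 m)))) ⟩
    0# + f m * 1#                                         ≈⟨ solve 1 (λ x → 𝟘 :+ x :* 𝟙 := x) refl (f m) ⟩
    f m                                                   ∎
    where
    t^0≈0 : ∀ {k} → 0 ℕ.< k → t^ 0 k ≈ 0#
    t^0≈0 (s≤s _) = refl

  ⊛-shift : ∀ f g m → (f ⊛ shift g) m ≈ shift (f ⊛ g) m
  ⊛-shift f g zero    = trans (+-identityʳ _) (zeroʳ _)
  ⊛-shift f g (suc m) = begin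
    (f ⊛ shift g) (suc m)
      ≈⟨ sum-snoc (suc m) (λ i → f i * shift g (suc m ∸ i)) ⟩
    ∑< (suc m) (λ i → f i * shift g (suc m ∸ i)) + f (suc m) * shift g (m ∸ m)
      ≈⟨ +-cong (sum-cong-≋ {suc m} λ i → *-congˡ {f (toℕ i)} (reflexive (≡.cong (shift g) (ℕ.+-∸-assoc 1 (ℕ.≤-pred (toℕ<n i))))))
           (trans (*-congˡ (reflexive (≡.cong (shift g) (ℕ.n∸n≡0 m)))) (zeroʳ _)) ⟩
    (f ⊛ g) m + 0#
      ≈⟨ +-identityʳ _ ⟩
    (f ⊛ g) m ∎

  -- For N = q^{n+1} the N-th power of the recurrence reads t λ^N - θ^N λ^N = λ^{qN}, taken
  -- coefficientwise. So each new factor t - θ^N of G raises all coefficients to the q-th power once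
  -- more.
  H⊛G : ∀ n → H ⊛ G n ≋ λ m → lam m ^ (q^ suc n) * ℓ n ⁻¹
  H⊛G zero m = begin
    (H ⊛ t^ 0) m                  ≈⟨ ⊛-1 H m ⟩
    lam m ^ q                     ≈⟨ ^-congʳ (lam m) (ℕ.*-identityʳ q) ⟨
    lam m ^ (q ℕ.* 1)             ≈⟨ trans (*-congˡ 1⁻¹≈1) (*-identityʳ _) ⟨
    lam m ^ (q ℕ.* 1) * 1# ⁻¹     ∎
  H⊛G (suc n) m = begin
    (H ⊛ G (suc n)) m
      ≈⟨ sum-cong-≋ {suc m} (λ i → solve 5 (λ h s Q g k → h :* ((s :- Q :* g) :* k) := (h :* s :- Q :* (h :* g)) :* k)
           refl (H (toℕ i)) (shift (G n) (m ∸ toℕ i)) Q (G n (m ∸ toℕ i)) k) ⟩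
    sum {suc m} (λ i → (H (toℕ i) * shift (G n) (m ∸ toℕ i) - Q * (H (toℕ i) * G n (m ∸ toℕ i))) * k)
      ≈⟨ sum-linear {suc m} Q k (λ i → H (toℕ i) * shift (G n) (m ∸ toℕ i)) (λ i → H (toℕ i) * G n (m ∸ toℕ i)) ⟩
    ((H ⊛ shift (G n)) m - Q * (H ⊛ G n) m) * k
      ≈⟨ *-congʳ (+-cong (trans (⊛-shift H (G n) m) (trans (shift-cong (H⊛G n) m) (trans (shift-*ʳ _ (ℓ n ⁻¹) m) (*-congʳ (shift-^ m)))))
           (-‿cong (*-congˡ (H⊛G n m)))) ⟩
    (shift lam m ^ N * ℓ n ⁻¹ - Q * (lam m ^ N * ℓ n ⁻¹)) * k
      ≈⟨ solve 5 (λ s l Q x k → (s :* l :- Q :* (x :* l)) :* k := (s :- Q :* x) :* (l :* k)) refl _ _ _ _ _ ⟩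
    (shift lam m ^ N - Q * lam m ^ N) * (ℓ n ⁻¹ * k)
      ≈⟨ *-cong (begin
           shift lam m ^ N - Q * lam m ^ N      ≈⟨ +-congˡ (-‿cong (^-distrib-* θ (lam m) N)) ⟨
           shift lam m ^ N - (θ * lam m) ^ N    ≈⟨ sub-^q^ (suc n) _ _ ⟨
           (shift lam m - θ * lam m) ^ N        ≈⟨ ^-congˡ N (lam-recurrence m) ⟩
           (lam m ^ q) ^ N                      ≈⟨ ^-assocʳ (lam m) q N ⟩
           lam m ^ (q^ suc (suc n))             ∎)
         (sym (⁻¹-distrib-* (ℓ≉0 n) (-‿≉0 [ n ]≉0))) ⟩
    lam m ^ (q^ suc (suc n)) * ℓ (suc n) ⁻¹ ∎
    where
    N = q^ suc n
    Q = θ ^ N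
    k = (- [ suc n ]q) ⁻¹

    shift-^ : ∀ m → shift (λ j → lam j ^ N) m ≈ shift lam m ^ N
    shift-^ zero    = sym (0^n≈0 N {{ℕ.m^n≢0 q (suc n)}})
    shift-^ (suc m) = refl

  -- From n to n+1 the numerator gains -θ^N, as ρ^{qN} = (-θ ρ)^N, and the inverse of ℓ gains -u^N
  -- `w n`; what remains is `w n`.
  root^/ℓ : ∀ n → root ^ (q^ suc n) * ℓ n ⁻¹ ≈ - (θ * root * ∏< n w)
  root^/ℓ zero = begin
    root ^ (q ℕ.* 1) * 1# ⁻¹     ≈⟨ trans (*-congˡ 1⁻¹≈1) (*-identityʳ _) ⟩
    root ^ (q ℕ.* 1)             ≈⟨ ^-congʳ root (ℕ.*-identityʳ q) ⟩
    root ^ q                     ≈⟨ root^q ⟩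
    - (θ * root)                 ≈⟨ -‿cong (*-identityʳ _) ⟨
    - (θ * root * 1#)            ∎
  root^/ℓ (suc n) = begin
    root ^ (q ℕ.* N) * (ℓ n * - [ suc n ]q) ⁻¹
      ≈⟨ *-cong (sym (^-assocʳ root q N)) (⁻¹-distrib-* (ℓ≉0 n) (-‿≉0 [ n ]≉0)) ⟩
    (root ^ q) ^ N * (ℓ n ⁻¹ * (- [ suc n ]q) ⁻¹)
      -- `- (θ * root)` is written as a difference from 0 so that `sub-^q^` gives the sign for q of
      -- either parity.
      ≈⟨ *-cong (trans (^-congˡ N (trans root^q (sym (+-identityˡ _)))) (sub-^q^ (suc n) 0# (θ * root))) (*-congˡ (-[n]⁻¹ n)) ⟩
    (0# ^ N - (θ * root) ^ N) * (ℓ n ⁻¹ * - (U * w n))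
      ≈⟨ *-congʳ (+-cong (0^n≈0 N {{ℕ.m^n≢0 q (suc n)}}) (-‿cong (^-distrib-* θ root N))) ⟩
    (0# - θ ^ N * root ^ N) * (ℓ n ⁻¹ * - (U * w n))
      ≈⟨ solve 5 (λ Q r l U w → (𝟘 :- Q :* r) :* (l :* (:- (U :* w))) := Q :* U :* (r :* l :* w)) refl _ _ _ _ _ ⟩
    θ ^ N * U * (root ^ N * ℓ n ⁻¹ * w n)
      ≈⟨ trans (*-congʳ (θ^n*u^n≈1 N)) (*-identityˡ _) ⟩
    root ^ N * ℓ n ⁻¹ * w n
      ≈⟨ *-congʳ (root^/ℓ n) ⟩
    - (θ * root * ∏< n w) * w n
      ≈⟨ solve 3 (λ x P w → (:- (x :* P)) :* w := :- (x :* (P :* w))) refl (θ * root) _ _ ⟩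
    - (θ * root * (∏< n w * w n))
      ≈⟨ -‿cong (*-congˡ (∏w-suc n)) ⟨
    - (θ * root * ∏< (suc n) w) ∎
    where
    N = q^ suc n
    U = u ^ N

  -- At positive index |λ| ≤ |ρ u|, so the quotient is at most |u|^N times that for ρ, which
  -- `root^/ℓ` keeps bounded.
  lam^/ℓ-rate : ∀ n m → lam m ^ (q^ suc n) * ℓ n ⁻¹ - const (- π̃) m ≼ θ * root * u ^ n
  lam^/ℓ-rate n zero = ≼-respˡ (begin
    lam 0 ^ (q^ suc n) * ℓ n ⁻¹ - - π̃       ≈⟨ +-cong (trans (*-congʳ (^-congˡ (q^ suc n) lam-zero)) (root^/ℓ n))
                                               (-‿cong (-‿cong formula)) ⟩
    - (θ * root * ∏< n w) - - (θ * root * P∞) ≈⟨ solve 3 (λ x p P → :- (x :* p) :- (:- (x :* P)) := x :* (:- (p :- P))) refl (θ * root) _ _ ⟩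
    θ * root * - (∏< n w - P∞)              ∎)
    (*-mono-≼ ≼-refl (-‿≼ (≼-trans (∏w-rate n) (u^-antimono (ℕ.n≤1+n n)))))
  lam^/ℓ-rate n (suc m) = ≼-respˡ (solve 1 (λ x → x :- 𝟘 := x) refl _)
    (≼-trans (*-mono-≼ (≼-respʳ (^-distrib-* root u N) (^-mono-≼ N (lam-suc≼ m))) (≼-refl {ℓ n ⁻¹}))
      (≼-respˡ (trans (solve 3 (λ r U l → r :* U :* l := r :* l :* U) refl _ _ _) (*-congʳ (root^/ℓ n)))
        (*-mono-≼ (-‿≼ (*-≼1 ≼-refl (∏w≼1 n))) (≼-trans (u^q^≼u^ (suc n)) (u^-antimono (ℕ.n≤1+n n))))))
    where N = q^ suc n

  -- The m-th coefficient of `H ⊛ G n` has two limits in n: that of the finite sum taken termwise,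
  -- and that given by `lam^/ℓ-rate`. They agree by uniqueness.
  H⊛L : H ⊛ L 1 ≋ const (- π̃)
  H⊛L m = rate-unique (λ n → (H ⊛ G n) m) (root ^ q) (θ * root)
    (λ n → ≼-respˡ (difference n) (sum-≼ {suc m} λ i →
      *-mono-≼ (^-mono-≼ q (lam≼root (toℕ i)))
        (≼-trans (G-rate n (m ∸ toℕ i)) (u^-antimono (ℕ.n≤1+n n)))))
    (λ n → ≼-respˡ (+-congʳ (H⊛G n m)) (lam^/ℓ-rate n m))
    where
    difference : ∀ n → (H ⊛ G n) m - (H ⊛ L 1) m ≈ ∑< (suc m) (λ i → H i * (G n (m ∸ i) - L 1 (m ∸ i)))
    difference n = begin
      (H ⊛ G n) m - (H ⊛ L 1) m
        ≈⟨ solve 2 (λ x y → x :- y := (x :- 𝟙 :* y) :* 𝟙) refl _ _ ⟩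
      ((H ⊛ G n) m - 1# * (H ⊛ L 1) m) * 1#
        ≈⟨ sum-linear {suc m} 1# 1# (λ i → H (toℕ i) * G n (m ∸ toℕ i)) (λ i → H (toℕ i) * L 1 (m ∸ toℕ i)) ⟨
      sum {suc m} (λ i → (H (toℕ i) * G n (m ∸ toℕ i) - 1# * (H (toℕ i) * L 1 (m ∸ toℕ i))) * 1#)
        ≈⟨ sum-cong-≋ {suc m} (λ i → solve 3 (λ h x y → (h :* x :- 𝟙 :* (h :* y)) :* 𝟙 := h :* (x :- y)) refl (H (toℕ i)) (G n (m ∸ toℕ i)) (L 1 (m ∸ toℕ i))) ⟩
      ∑< (suc m) (λ i → H i * (G n (m ∸ i) - L 1 (m ∸ i))) ∎

  π̃≉0 : ¬ (- π̃ ≈ 0#)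
  π̃≉0 = -‿≉0 λ e → *-≉0 (*-≉0 θ≉0 root≉0) P∞≉0 (trans (sym formula) e)

  -- `H⊛L` hands over the inverse of the denominator, namely L(χ_t,1) divided by -π̃; the quotient
  -- is then L(χ_t,1) by cancelling that constant.
  L-formula : L 1 ≋ const (- π̃) / ((t ⊖ const θ) ⊛ sCar π̃)
  L-formula = v , inverse , λ m → begin
    L 1 m                                ≈⟨ *-identityˡ _ ⟨
    1# * L 1 m                           ≈⟨ *-congʳ (*-inverseʳ _ π̃≉0) ⟨
    - π̃ * (- π̃) ⁻¹ * L 1 m               ≈⟨ solve 3 (λ x y z → x :* y :* z := x :* (z :* y)) refl _ _ _ ⟩
    - π̃ * v m                            ≈⟨ const-⊛ (- π̃) v m ⟨
    (const (- π̃) ⊛ v) m                  ∎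
    where
    v : PowerSeries
    v m = L 1 m * (- π̃) ⁻¹

    inverse : ((t ⊖ const θ) ⊛ lam) ⊛ v ≋ const 1#
    inverse m = begin
      (((t ⊖ const θ) ⊛ lam) ⊛ v) m                  ≈⟨ ⊛-cong {g = v} [t-θ]s≋H m ⟩
      (H ⊛ v) m                                      ≈⟨ sum-cong-≋ {suc m} (λ i → *-assoc (H (toℕ i)) (L 1 (m ∸ toℕ i)) ((- π̃) ⁻¹)) ⟨
      sum {suc m} (λ i → H (toℕ i) * L 1 (m ∸ toℕ i) * (- π̃) ⁻¹)
                                                     ≈⟨ *-distribʳ-sum {suc m} ((- π̃) ⁻¹) (λ i → H (toℕ i) * L 1 (m ∸ toℕ i)) ⟨
      (H ⊛ L 1) m * (- π̃) ⁻¹                         ≈⟨ *-congʳ (H⊛L m) ⟩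
      const (- π̃) m * (- π̃) ⁻¹                       ≈⟨ constant m ⟩
      const 1# m                                     ∎
      where
      constant : ∀ m → const (- π̃) m * (- π̃) ⁻¹ ≈ const 1# m
      constant zero    = *-inverseʳ _ π̃≉0
      constant (suc m) = zeroˡ _

open import Data.Nat.Base using (_^_; _>_)

theorem1 : ∀ {a ℓ₁ c ℓ₂} (p e : ℕ) → Prime p → e > 0 →
    (𝔽q : FiniteField a ℓ₁ (p ^ e)) (ℂ∞ : Cinf 𝔽q c ℓ₂) →
    let open Cinf ℂ∞
        open Carlitz ℂ∞
    in (π̃ : Carrier) → IsFundamentalPeriod π̃ →
    L 1 ≋ const (- π̃) / ((t ⊖ const θ) ⊛ sCar π̃)
theorem1 p e p-prime e>0 𝔽q ℂ∞ = CarlitzPeriod.L-formula ℂ∞ 1<q (Frobenius.+-^p^ p-prime p≈0 e)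
  where
  open import Data.Nat.Base using (nonTrivial⇒n>1)
  open import Data.Nat.Primality using (prime⇒nonTrivial)
  open import Data.Nat.Properties using (^-monoʳ-<)
  open import Relation.Binary.PropositionalEquality.Core using (refl)
  open FieldProperties (Cinf.fld ℂ∞) using (module Frobenius)

  1<q : 1 ℕ.< p ^ e
  1<q = ^-monoʳ-< p (nonTrivial⇒n>1 p {{prime⇒nonTrivial p-prime}}) e>0

  p≈0 = Valuation.ι-×≈0 ℂ∞ p (FiniteFieldProperties.base×1≈0 𝔽q p e refl)
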